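{- Let $K$ be a commutative ring with unit containing $\mathbb{Q}$, let $n\ge 1$, let $A=(A_{ij})_{1\le i,j\le n}$ be any $n\times n$ matrix with entries in $K$, let $1\le p\le n$, and let $I=\{i_1,\ldots,i_p\}$, $J=\{j_1,\ldots,j_p\}$ be two $p$-element subsets of $[n]=\{1,\ldots,n\}$ with $i_1<\cdots<i_p$ and $j_1<\cdots<j_p$. Then \[ \det(A_{I^{c},J^{c}})=(-1)^{\Sigma I+\Sigma J}\sum_{(\mathcal F,\mathcal R)\ \text{admissible}}\epsilon(\mathcal F)\prod_{j\in\mathcal R}\Big(\sum_{i=1}^n A_{ij}\Big)\prod_{(i,j)\in\mathcal F}(-A_{ij}), \] where the sum runs over all admissible pairs $(\mathcal F,\mathcal R)$ with $\mathcal F\subseteq[n]\times[n]$ and $\mathcal R\subseteq[n]$ (admissibility and $\epsilon(\mathcal F)$ being relative to $I$ and $J$).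
   Context: $A_{I^c,J^c}$ denotes the $(n-p)\times(n-p)$ matrix obtained from $A$ by deleting the rows with index in $I$ and the columns with index in $J$ (its determinant is $1$ if $p=n$). $\Sigma I=i_1+\cdots+i_p$, $\Sigma J=j_1+\cdots+j_p$. A forest is a set of 2-element subsets of $[n]$ such that the graph with vertex set $[n]$ and that edge set has no cycle. A directed forest is a set $\mathcal F$ of pairs $(u,v)\in[n]\times[n]$ with $u\ne v$, such that $(u,v)\in\mathcal F$ implies $(v,u)\notin\mathcal F$, and such that $\{\{u,v\}:(u,v)\in\mathcal F\}$ is a forest; $(u,v)$ is regarded as an edge oriented from $u$ to $v$. $\Pi_{\mathcal F}$ denotes the partition of $[n]$ into connected components of this undirected forest; inside each block, $\mathcal F$ restricts to a directed tree spanning the block. For a vertex $r$ of a block $C$, "all edges of the tree on $C$ are oriented away from $r$" means every $(u,v)\in\mathcal F$ with $u,v\in C$ has $u$ on the unique path in the tree from $r$ to $v$. A directed forest $\mathcal F$ is admissible (w.r.t. $I,J$) if: (i) every block $C\in\Pi_{\mathcal F}$ either satisfies $C\cap(I\cup J)=\emptyset$, or both $C\cap I$ and $C\cap J$ are singletons; (ii) in every block $C$ containing some $i\in I$ and $j\in J$, all edges of the tree on $C$ are oriented away from $j$. For admissible $\mathcal F$, $\sigma_{\mathcal F}$ is the unique permutation of $[p]$ such that for all $\alpha$, $j_\alpha$ and $i_{\sigma_{\mathcal F}(\alpha)}$ lie in the same block of $\Pi_{\mathcal F}$, and $\epsilon(\mathcal F)$ is the signature of $\sigma_{\mathcal F}$.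 A pair $(\mathcal F,\mathcal R)$ with $\mathcal F\subseteq[n]\times[n]$, $\mathcal R\subseteq[n]$ is admissible if: $\mathcal F$ is an admissible directed forest; every block $C\in\Pi_{\mathcal F}$ with $C\cap(I\cup J)=\emptyset$ contains exactly one element of $\mathcal R$, and $\mathcal R$ is contained in the union of such blocks; and in each such block $C$ all edges of the tree on $C$ are oriented away from the unique element of $C\cap\mathcal R$. -}

module Defs where

open import Level using (Level; _⊔_)
open import Data.Nat as ℕ using (ℕ; zero; suc; _≤_)
open import Data.Fin as Fin using (Fin; toℕ)
open import Data.Fin.Properties using (any?)
open import Data.Nat.ListAction using (sum)
open import Data.Bool using (Bool; true; false; if_then_else_)
open import Data.Vec as Vec using (Vec; lookup)
open import Data.List as List using (List; []; _∷_; _++_; [_]; filter; allFin; length; map; foldr)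
open import Data.List.Relation.Unary.Unique.Propositional using (Unique)
open import Data.List.Membership.Propositional renaming (_∈_ to _∈ₗ_)
open import Data.Product using (Σ; ∃; _×_; _,_; proj₁; proj₂; Σ-syntax; ∃-syntax)
open import Data.Sum using (_⊎_)
open import Relation.Nullary using (¬_; ¬?)
open import Relation.Nullary.Decidable using (_×-dec_)
open import Relation.Binary.PropositionalEquality using (_≡_)
open import Algebra.Bundles using (CommutativeRing)

-- Index conventions: [n] = {1,…,n} is represented by Fin n, the element
-- k-1 : Fin n standing for k.  A p-element subset I = {i₁<…<iₚ} is given
-- by the strictly increasing map α ↦ i_α : Fin p → Fin n.

StrictlyIncreasing : ∀ {p n} → (Fin p → Fin n) → Set
StrictlyIncreasing {p} i = ∀ (α β : Fin p) → α Fin.< β → i α Fin.< i β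

-- Σ I = i₁ + ⋯ + iₚ  (with the 1-based values of the indices)
indexSum : ∀ {p n} → (Fin p → Fin n) → ℕ
indexSum {p} i = sum (map (λ α → suc (toℕ (i α))) (allFin p))

complement : ∀ {p n} → (Fin p → Fin n) → List (Fin n)
complement {p} {n} i = filter (λ x → ¬? (any? (λ α → i α Fin.≟ x))) (allFin n)

-- A subset F ⊆ [n]×[n]: (u,v) ∈ F iff lookup (lookup F u) v ≡ true.
Rel : ℕ → Set
Rel n = Vec (Vec Bool n) n

Sub : ℕ → Set
Sub n = Vec Bool n

module _ {n : ℕ} (F : Rel n) where

  Edge : Fin n → Fin n → Set
  Edge u v = lookup (lookup F u) v ≡ true

  Adj : Fin n → Fin n → Set
  Adj u v = Edge u v ⊎ Edge v u

  data Walk : Fin n → Fin n → List (Fin n) → Set where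
    here : ∀ {a} → Walk a a (a ∷ [])
    step : ∀ {a b c vs} → Adj a b → Walk b c vs → Walk a c (a ∷ vs)

  HasCycle : Set
  HasCycle = Σ[ a ∈ Fin n ] Σ[ b ∈ Fin n ] Σ[ vs ∈ List (Fin n) ]
               (Walk a b vs × Unique vs × 3 ≤ length vs × Adj b a)

  IsDirectedForest : Set
  IsDirectedForest = (∀ u → ¬ Edge u u)
                   × (∀ u v → Edge u v → ¬ Edge v u)
                   × ¬ HasCycle

  Connected : Fin n → Fin n → Set
  Connected a b = ∃[ vs ] Walk a b vs

  -- u lies on the (unique, in a forest) path from r to v
  OnPath : Fin n → Fin n → Fin n → Set
  OnPath u r v = Σ[ vs ∈ List (Fin n) ] (Walk r v vs × Unique vs × u ∈ₗ vs)

  OrientedAwayFrom : Fin n → Set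
  OrientedAwayFrom r = ∀ u v → Edge u v → Connected r v → OnPath u r v

module _ {n p : ℕ} (i j : Fin p → Fin n) (F : Rel n) where

  Free : Fin n → Set
  Free x = ∀ α → ¬ Connected F x (i α) × ¬ Connected F x (j α)

  ExactlyOne : (Fin p → Fin n) → Fin n → Set
  ExactlyOne k x = Σ[ α ∈ Fin p ] (Connected F x (k α)
                     × ∀ β → Connected F x (k β) → β ≡ α)

  AdmissibleForest : Set
  AdmissibleForest =
      IsDirectedForest F
    × (∀ x → Free x ⊎ (ExactlyOne i x × ExactlyOne j x))
    × (∀ α β → Connected F (i α) (j β) → OrientedAwayFrom F (j β))

  AdmissiblePair : Sub n → Set
  AdmissiblePair R =
      AdmissibleForest
    × (∀ x → Free x → Σ[ r ∈ Fin n ] (lookup R r ≡ true × Connected F x r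
                 × ∀ r' → lookup R r' ≡ true → Connected F x r' → r' ≡ r))
    × (∀ r → lookup R r ≡ true → Free r)
    × (∀ r → lookup R r ≡ true → OrientedAwayFrom F r)

  IsSigma : Vec (Fin p) p → Set
  IsSigma σ = ∀ α → Connected F (j α) (i (lookup σ α))

inversions : ∀ {p} → Vec (Fin p) p → ℕ
inversions {p} σ = length (filter
  (λ ab → (proj₁ ab Fin.<? proj₂ ab) ×-dec (lookup σ (proj₂ ab) Fin.<? lookup σ (proj₁ ab)))
  (List.cartesianProduct (allFin p) (allFin p)))

-- Triples (F , R , σ_F) indexing the sum
Triple : ℕ → ℕ → Set
Triple n p = Rel n × Sub n × Vec (Fin p) p

EnumeratesAdmissible : ∀ {n p} → (i j : Fin p → Fin n) → List (Triple n p) → Set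
EnumeratesAdmissible i j L =
    Unique L
  × (∀ F R σ → (F , R , σ) ∈ₗ L → AdmissiblePair i j F R × IsSigma i j F σ)
  × (∀ F R σ → AdmissiblePair i j F R × IsSigma i j F σ → (F , R , σ) ∈ₗ L)

module _ {c ℓ : Level} (K : CommutativeRing c ℓ) where
  open CommutativeRing K

  sumL : List Carrier → Carrier
  sumL = foldr _+_ 0#

  prodL : List Carrier → Carrier
  prodL = foldr _*_ 1#

  negPow : ℕ → Carrier
  negPow zero = 1#
  negPow (suc k) = - negPow k

  signature : ∀ {p} → Vec (Fin p) p → Carrier
  signature σ = negPow (inversions σ)

  -- determinant of the square matrix (A r c) with r running through the
  -- list rs and c through the list cs (in the given orders), defined by
  -- Laplace expansion along the first row; det of the 0×0 matrix is 1.
  mutual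
    det : ∀ {n} → (Fin n → Fin n → Carrier) → List (Fin n) → List (Fin n) → Carrier
    det A [] cs = 1#
    det A (r ∷ rs) cs = expand A r rs [] cs 0

    expand : ∀ {n} → (Fin n → Fin n → Carrier) → Fin n → List (Fin n)
           → List (Fin n) → List (Fin n) → ℕ → Carrier
    expand A r rs pre [] k = 0#
    expand A r rs pre (c ∷ post) k =
      negPow k * A r c * det A rs (pre ++ post) + expand A r rs (pre ++ [ c ]) post (suc k)

  minor : ∀ {n p} → (Fin n → Fin n → Carrier) → (i j : Fin p → Fin n) → Carrier
  minor A i j = det A (complement i) (complement j)

  colSum : ∀ {n} → (Fin n → Fin n → Carrier) → Fin n → Carrier
  colSum {n} A v = sumL (map (λ u → A u v) (allFin n))

  summand : ∀ {n p} → (Fin n → Fin n → Carrier) → Triple n p → Carrier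
  summand {n} A (F , R , σ) =
    signature σ
    * (prodL (map (λ v → if lookup R v then colSum A v else 1#) (allFin n))
    * prodL (map (λ u → prodL (map (λ v → if lookup (lookup F u) v then - A u v else 1#)
                                   (allFin n))) (allFin n)))

  sumOver : ∀ {n p} → (Fin n → Fin n → Carrier) → List (Triple n p) → Carrier
  sumOver A L = sumL (map (summand A) L)

{-# OPTIONS --safe #-}
-- Column v of A equals colSum v · e_v + Σ_u (- A u v) (e_v - e_u).  Putting e_{i_α} in place of
-- column j_α turns the minor into a full determinant (up to the sign (-1)^{ΣI+ΣJ}), and expanding
-- the remaining columns multilinearly gives a sum over all parent maps f : [n] ∖ J → [n] ∪ {none},
-- where none marks a root.  The determinant with columns e_v - e_{f v} (e_v at a root) is evaluated
-- by column operations.  A cycle of f makes its columns sum to zero.  If f is acyclic, column v may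
-- be changed to e_v - e_{top v}, top v being the root above v; two elements of I below the same
-- root, or one below a root outside J, make the columns dependent, and otherwise
-- top i_{σ(α)} = j_α for a permutation σ and the determinant is the sign of σ.  The surviving f are
-- exactly the admissible pairs: f v = u iff (u, v) ∈ F, and R is the set of roots outside J.
module Submission where

open import Defs
import Level
open import Algebra.Bundles using (CommutativeRing)
open import Algebra.Morphism.Structures using (module RingMorphisms)
import Algebra.Properties.Ring as RingProperties
open import Data.Bool using (true; false; if_then_else_)
import Data.Bool.Properties as Boolₚ
open import Data.Empty using (⊥)
open import Data.Fin as Fin using (Fin; zero; suc; toℕ; punchIn; punchOut)
import Data.Fin.Properties as Finₚ
open import Data.Fin.Properties using (any?)
open import Data.List as List using (List; []; _∷_; _++_; [_]; map; length; tabulate; allFin; filter; mapMaybe; cartesianProduct; cartesianProductWith)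
open import Data.List.Properties using (++-assoc; map-++; map-∘; map-cong; map-tabulate; length-tabulate; length-map; length-++; filter-++; filter-all; filter-none; filter-accept; filter-reject)
open import Data.List.Membership.Propositional using (_∈_; _∉_)
open import Data.List.Membership.Propositional.Properties using (∈-allFin; ∈-map⁺; ∈-map⁻; ∈-cartesianProductWith⁺; ∈-cartesianProductWith⁻)
open import Data.List.Membership.Propositional.Properties.WithK using (unique∧set⇒bag)
open import Data.List.Relation.Binary.BagAndSetEquality using (∼bag⇒↭)
open import Data.List.Relation.Binary.Permutation.Propositional as Perm using (_↭_)
open import Data.List.Relation.Binary.Permutation.Propositional.Properties using (filter-↭; ↭-length)
open import Data.List.Relation.Binary.Pointwise as PW using (Pointwise; []; _∷_)
open import Data.List.Relation.Unary.All as All using (All; []; _∷_)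
import Data.List.Relation.Unary.All.Properties as Allₚ
open import Data.List.Relation.Unary.AllPairs using ([]; _∷_)
open import Data.List.Relation.Unary.Any using (here; there)
open import Data.List.Relation.Unary.Unique.Propositional using (Unique)
import Data.List.Relation.Unary.Unique.Propositional.Properties as Uniqueₚ
open import Data.Maybe using (Maybe; just; nothing; fromMaybe; maybe′)
open import Data.Maybe.Properties using (just-injective; ≡-dec)
open import Data.Nat as ℕ using (ℕ; zero; suc; _≤_)
open import Data.Nat.ListAction using (sum)
import Data.Nat.Properties as ℕₚ
open import Data.Nat.Solver using (module +-*-Solver)
open import Data.Product using (Σ; _×_; _,_; proj₁; proj₂; ∃; ∃₂)
open import Data.Rational using (ℚ)
open import Data.Rational.Properties using (+-*-commutativeRing)
open import Data.Sum using (_⊎_; inj₁; inj₂)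
open import Data.Vec as Vec using (Vec; []; _∷_; lookup)
open import Data.Vec.Properties using (lookup∘tabulate; tabulate∘lookup; tabulate-cong; ∷-injective)
open import Function using (_∘_; case_of_; mk⇔)
open import Relation.Binary.Definitions using (tri<; tri≈; tri>)
open import Relation.Binary.PropositionalEquality as ≡ using (_≡_; _≢_; cong)
import Relation.Binary.Reasoning.Setoid as SetoidReasoning
open import Relation.Nullary using (¬_; Dec; does; contradiction; yes; no; ¬?)
open import Relation.Nullary.Decidable using (_×-dec_; dec-true)
open import Relation.Unary using (Pred; Decidable)

-- Multilinear alternating determinants of columns

-- The columns in J are never expanded. This makes every element of J a root of every parent map
-- that occurs, and it is why a tree meeting J is oriented away from its element of J.
--
-- The equality of `K` is a setoid relation without a decision procedure, so linear dependence is
-- always exhibited by explicit column operations. When many columns have to be changed, an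
-- intermediate family holds some old and some new columns, and each single operation must be valid
-- for every such mixture; `D-sweep` isolates this pattern. Families of columns are functions and
-- are compared pointwise.
--
-- The sign enters through its inverse. Replacing e_(i (σ α)) by e_(j α) in slot `j α` is a column
-- operation, so the determinant with the labels rearranged by `σ` equals 1. By antisymmetry it also
-- equals the sign times the determinant sought, and a sign is its own inverse.

module Determinant {c ℓ} (K : CommutativeRing c ℓ) {n : ℕ} where
  open CommutativeRing K hiding (zero)
  open RingProperties ring
  open SetoidReasoning setoid

  Column : Set c
  Column = Fin n → Carrier

  infix 4 _≋_
  _≋_ : Column → Column → Set ℓ
  x ≋ y = ∀ r → x r ≈ y r

  AgreeOn : List (Fin n) → Column → Column → Set ℓ
  AgreeOn rs x y = All (λ r → x r ≈ y r) rs

  agreeOn : ∀ {rs x y} → x ≋ y → AgreeOn rs x y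
  agreeOn {rs} eq = All.universal eq rs

  -- Unlike det, columnDet vanishes when there are more columns than rows, which
  -- makes it multilinear without a side condition on the lengths.
  mutual
    columnDet : List (Fin n) → List Column → Carrier
    columnDet []       []       = 1#
    columnDet []       (_ ∷ _)  = 0#
    columnDet (r ∷ rs) cs       = columnExpand r rs [] cs 0

    columnExpand : Fin n → List (Fin n) → List Column → List Column → ℕ → Carrier
    columnExpand r rs pre []         k = 0#
    columnExpand r rs pre (x ∷ post) k =
      negPow K k * x r * columnDet rs (pre ++ post) + columnExpand r rs (pre ++ [ x ]) post (suc k)

  module _ (A : Fin n → Fin n → Carrier) where
    column : Fin n → Column
    column v r = A r v

    mutual
      -- Both Laplace expansions follow the same recursion and differ only when the rows run out
      -- before the columns, where `det` is 1 and `columnDet` is 0; equal lengths exclude that case.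
      det≡columnDet : ∀ rs cs → length rs ≡ length cs →
                      det K A rs cs ≡ columnDet rs (map column cs)
      det≡columnDet []       []  eq = ≡.refl
      det≡columnDet (r ∷ rs) cs  eq = expand≡columnExpand r rs [] cs 0 eq

      expand≡columnExpand : ∀ r rs pre post k → suc (length rs) ≡ length (pre ++ post) →
        expand K A r rs pre post k ≡ columnExpand r rs (map column pre) (map column post) k
      expand≡columnExpand r rs pre []         k eq = ≡.refl
      expand≡columnExpand r rs pre (v ∷ post) k eq = ≡.cong₂ _+_
        (cong (negPow K k * A r v *_) (≡.trans
          (det≡columnDet rs (pre ++ post) (ℕₚ.suc-injective (≡.trans eq (length-mid pre post))))
          (cong (columnDet rs) (map-++ column pre post))))
        (≡.trans (expand≡columnExpand r rs (pre ++ [ v ]) post (suc k)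
                   (≡.trans eq (cong length (≡.sym (++-assoc pre [ v ] post)))))
          (cong (λ ys → columnExpand r rs ys (map column post) (suc k)) (map-++ column pre [ v ])))
        where
        length-mid : ∀ (xs ys : List (Fin n)) → length (xs ++ v ∷ ys) ≡ suc (length (xs ++ ys))
        length-mid []       ys = ≡.refl
        length-mid (x ∷ xs) ys = cong suc (length-mid xs ys)

  mutual
    -- Only entries in the rows `rs` are ever read. In `columnExpand-congOn` the columns already
    -- passed over enter through minors alone, so they need not agree in row `r`.
    columnDet-congOn : ∀ rs {xs ys} → Pointwise (AgreeOn rs) xs ys →
                       columnDet rs xs ≈ columnDet rs ys
    columnDet-congOn []       []       = refl
    columnDet-congOn []       (_ ∷ _)  = refl
    columnDet-congOn (r ∷ rs) eqs      = columnExpand-congOn r rs [] eqs 0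

    columnExpand-congOn : ∀ r rs {ps qs xs ys} → Pointwise (AgreeOn rs) ps qs →
      Pointwise (AgreeOn (r ∷ rs)) xs ys →
      ∀ k → columnExpand r rs ps xs k ≈ columnExpand r rs qs ys k
    columnExpand-congOn r rs pq []                k = refl
    columnExpand-congOn r rs pq ((eq ∷ eqs) ∷ xy) k =
      +-cong (*-cong (*-cong refl eq) (columnDet-congOn rs (PW.++⁺ pq (PW.map All.tail xy))))
             (columnExpand-congOn r rs (PW.++⁺ pq (eqs ∷ [])) xy (suc k))

  columnDet-cong : ∀ rs {xs ys} → Pointwise _≋_ xs ys → columnDet rs xs ≈ columnDet rs ys
  columnDet-cong rs eqs = columnDet-congOn rs (PW.map agreeOn eqs)

  pointwise-refl : ∀ {xs} → Pointwise _≋_ xs xs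
  pointwise-refl = PW.refl (λ _ → refl)

  private
    scale-swap : ∀ s a d → s * (a * d) ≈ a * (s * d)
    scale-swap s a d = begin
      s * (a * d) ≈⟨ *-assoc s a d ⟨
      s * a * d   ≈⟨ *-congʳ (*-comm s a) ⟩
      a * s * d   ≈⟨ *-assoc a s d ⟩
      a * (s * d) ∎

    combine : ∀ {t u v t' u' v'} a b → t ≈ a * u + b * v → t' ≈ a * u' + b * v' →
              t + t' ≈ a * (u + u') + b * (v + v')
    combine {t} {u} {v} {t'} {u'} {v'} a b p q = begin
      t + t'                                    ≈⟨ +-cong p q ⟩
      (a * u + b * v) + (a * u' + b * v')       ≈⟨ +-assoc _ _ _ ⟩
      a * u + (b * v + (a * u' + b * v'))       ≈⟨ +-congˡ (+-assoc _ _ _) ⟨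
      a * u + ((b * v + a * u') + b * v')       ≈⟨ +-congˡ (+-congʳ (+-comm _ _)) ⟩
      a * u + ((a * u' + b * v) + b * v')       ≈⟨ +-congˡ (+-assoc _ _ _) ⟩
      a * u + (a * u' + (b * v + b * v'))       ≈⟨ +-assoc _ _ _ ⟨
      (a * u + a * u') + (b * v + b * v')       ≈⟨ +-cong (distribˡ a u u') (distribˡ b v v') ⟨
      a * (u + u') + b * (v + v')               ∎

    combine-scale : ∀ {t u v} s a b → t ≈ a * u + b * v → s * t ≈ a * (s * u) + b * (s * v)
    combine-scale {t} {u} {v} s a b p = begin
      s * t                         ≈⟨ *-congˡ p ⟩
      s * (a * u + b * v)           ≈⟨ distribˡ s _ _ ⟩
      s * (a * u) + s * (b * v)     ≈⟨ +-cong (scale-swap s a u) (scale-swap s b v) ⟩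
      a * (s * u) + b * (s * v)     ∎

    combine-scaleʳ : ∀ {t u v} s d a b → t ≈ a * u + b * v →
                     s * t * d ≈ a * (s * u * d) + b * (s * v * d)
    combine-scaleʳ {t} {u} {v} s d a b p = begin
      s * t * d                     ≈⟨ *-comm _ d ⟩
      d * (s * t)                   ≈⟨ combine-scale d a b (combine-scale s a b p) ⟩
      a * (d * (s * u)) + b * (d * (s * v))
                                    ≈⟨ +-cong (*-congˡ (*-comm d _)) (*-congˡ (*-comm d _)) ⟩
      a * (s * u * d) + b * (s * v * d) ∎

  combine-zero : ∀ a b → 0# ≈ a * 0# + b * 0#
  combine-zero a b = sym (trans (+-cong (zeroʳ a) (zeroʳ b)) (+-identityˡ 0#))

  Combination : Carrier → Carrier → Column → Column → Column → Set ℓ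
  Combination a b x y z = ∀ r → z r ≈ a * x r + b * y r

  mutual
    -- During the expansion the distinguished column is still ahead, or is being picked (its entry
    -- in row `r` is the linear factor), or has been passed over and sits in every remaining minor;
    -- the mutual lemmas cover these positions. With no rows left, all the determinants are zero
    -- because a column remains.
    columnDet-linear : ∀ rs p {q a b x y z} → Combination a b x y z →
      columnDet rs (p ++ z ∷ q) ≈ a * columnDet rs (p ++ x ∷ q) + b * columnDet rs (p ++ y ∷ q)
    columnDet-linear []       []      {a = a} {b} eq = combine-zero a b
    columnDet-linear []       (_ ∷ _) {a = a} {b} eq = combine-zero a b
    columnDet-linear (r ∷ rs) p       eq = columnExpand-linear-post r rs [] p 0 eq

    columnExpand-linear-post : ∀ r rs pre p {q a b x y z} k → Combination a b x y z →
      columnExpand r rs pre (p ++ z ∷ q) k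
        ≈ a * columnExpand r rs pre (p ++ x ∷ q) k + b * columnExpand r rs pre (p ++ y ∷ q) k
    columnExpand-linear-post r rs pre []      {q} {a} {b} k eq =
      combine a b (combine-scaleʳ (negPow K k) _ a b (eq r))
                  (columnExpand-linear-pre r rs pre [] q (suc k) eq)
    columnExpand-linear-post r rs pre (w ∷ p) {q} {a} {b} {x} {y} {z} k eq =
      combine a b (combine-scale _ a b inner)
                  (columnExpand-linear-post r rs (pre ++ [ w ]) p (suc k) eq)
      where
      inner : columnDet rs (pre ++ p ++ z ∷ q)
                ≈ a * columnDet rs (pre ++ p ++ x ∷ q) + b * columnDet rs (pre ++ p ++ y ∷ q)
      inner rewrite ≡.sym (++-assoc pre p (x ∷ q)) | ≡.sym (++-assoc pre p (y ∷ q))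
                  | ≡.sym (++-assoc pre p (z ∷ q)) = columnDet-linear rs (pre ++ p) eq

    columnExpand-linear-pre : ∀ r rs p q post {a b x y z} k → Combination a b x y z →
      columnExpand r rs (p ++ z ∷ q) post k
        ≈ a * columnExpand r rs (p ++ x ∷ q) post k + b * columnExpand r rs (p ++ y ∷ q) post k
    columnExpand-linear-pre r rs p q []         {a} {b} k eq = combine-zero a b
    columnExpand-linear-pre r rs p q (w ∷ post) {a} {b} {x} {y} {z} k eq =
      combine a b (combine-scale _ a b inner) rest
      where
      inner : columnDet rs ((p ++ z ∷ q) ++ post)
                ≈ a * columnDet rs ((p ++ x ∷ q) ++ post) + b * columnDet rs ((p ++ y ∷ q) ++ post)
      inner rewrite ++-assoc p (x ∷ q) post | ++-assoc p (y ∷ q) post | ++-assoc p (z ∷ q) post =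
        columnDet-linear rs p eq
      rest : columnExpand r rs ((p ++ z ∷ q) ++ [ w ]) post (suc k)
               ≈ a * columnExpand r rs ((p ++ x ∷ q) ++ [ w ]) post (suc k)
               + b * columnExpand r rs ((p ++ y ∷ q) ++ [ w ]) post (suc k)
      rest rewrite ++-assoc p (x ∷ q) [ w ] | ++-assoc p (y ∷ q) [ w ] | ++-assoc p (z ∷ q) [ w ] =
        columnExpand-linear-pre r rs p (q ++ [ w ]) post (suc k) eq

  columnDet-zero : ∀ rs p {q x} → AgreeOn rs x (λ _ → 0#) → columnDet rs (p ++ x ∷ q) ≈ 0#
  columnDet-zero rs p {q} {x} eq = begin
    columnDet rs (p ++ x ∷ q)          ≈⟨ columnDet-congOn rs
                                            (PW.++⁺ (PW.refl (agreeOn (λ _ → refl)))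
                                                    (eq ∷ PW.refl (agreeOn (λ _ → refl)))) ⟩
    columnDet rs (p ++ (λ _ → 0#) ∷ q) ≈⟨ columnDet-linear rs p {a = 0#} {0#} {x} {x}
                                            (λ r → sym (trans (+-cong (zeroˡ _) (zeroˡ _)) (+-identityˡ 0#))) ⟩
    0# * columnDet rs (p ++ x ∷ q) + 0# * columnDet rs (p ++ x ∷ q)
                                       ≈⟨ +-cong (zeroˡ _) (zeroˡ _) ⟩
    0# + 0#                            ≈⟨ +-identityˡ 0# ⟩
    0#                                 ∎

  private
    0+0 : ∀ {s t d} → d ≈ 0# → t ≈ 0# → s * d + t ≈ 0#
    0+0 {s} p q = trans (+-cong (trans (*-congˡ p) (zeroʳ s)) q) (+-identityˡ 0#)

  mutual
    -- Picking `x` and picking `y` give equal minors with opposite signs, and every other term has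
    -- `x` and `y` adjacent in its minor. This comes before antisymmetry, which then follows without
    -- division by 2.
    columnDet-adjacent : ∀ rs p {q x y} → x ≋ y → columnDet rs (p ++ x ∷ y ∷ q) ≈ 0#
    columnDet-adjacent []       []      eq = refl
    columnDet-adjacent []       (_ ∷ _) eq = refl
    columnDet-adjacent (r ∷ rs) p       eq = columnExpand-adjacent-post r rs [] p 0 eq

    columnExpand-adjacent-post : ∀ r rs pre p {q x y} k → x ≋ y →
      columnExpand r rs pre (p ++ x ∷ y ∷ q) k ≈ 0#
    columnExpand-adjacent-post r rs pre [] {q} {x} {y} k eq = begin
      s * x r * columnDet rs (pre ++ y ∷ q)
        + (- s * y r * columnDet rs ((pre ++ [ x ]) ++ q) + rest)
          ≈⟨ +-congˡ (+-cong (*-cong (*-congˡ (sym (eq r))) minors) rest≈0) ⟩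
      s * x r * d + (- s * x r * d + 0#)
          ≈⟨ +-congˡ (trans (+-identityʳ _) (*-congʳ (sym (-‿distribˡ-* s (x r))))) ⟩
      s * x r * d + (- (s * x r)) * d  ≈⟨ distribʳ d _ _ ⟨
      (s * x r + - (s * x r)) * d      ≈⟨ *-congʳ (-‿inverseʳ _) ⟩
      0# * d                           ≈⟨ zeroˡ d ⟩
      0#                               ∎
      where
      s = negPow K k
      d = columnDet rs (pre ++ y ∷ q)
      rest = columnExpand r rs ((pre ++ [ x ]) ++ [ y ]) q (suc (suc k))
      minors : columnDet rs ((pre ++ [ x ]) ++ q) ≈ d
      minors rewrite ++-assoc pre [ x ] q =
        columnDet-cong rs (PW.++⁺ pointwise-refl (eq ∷ pointwise-refl))
      rest≈0 : rest ≈ 0#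
      rest≈0 rewrite ++-assoc pre [ x ] [ y ] = columnExpand-adjacent-pre r rs pre [] q (suc (suc k)) eq
    columnExpand-adjacent-post r rs pre (w ∷ p) {q} {x} {y} k eq =
      0+0 inner (columnExpand-adjacent-post r rs (pre ++ [ w ]) p (suc k) eq)
      where
      inner : columnDet rs (pre ++ p ++ x ∷ y ∷ q) ≈ 0#
      inner rewrite ≡.sym (++-assoc pre p (x ∷ y ∷ q)) = columnDet-adjacent rs (pre ++ p) eq

    columnExpand-adjacent-pre : ∀ r rs p q post {x y} k → x ≋ y →
      columnExpand r rs (p ++ x ∷ y ∷ q) post k ≈ 0#
    columnExpand-adjacent-pre r rs p q []         k eq = refl
    columnExpand-adjacent-pre r rs p q (w ∷ post) {x} {y} k eq = 0+0 inner rest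
      where
      inner : columnDet rs ((p ++ x ∷ y ∷ q) ++ post) ≈ 0#
      inner rewrite ++-assoc p (x ∷ y ∷ q) post = columnDet-adjacent rs p eq
      rest : columnExpand r rs ((p ++ x ∷ y ∷ q) ++ [ w ]) post (suc k) ≈ 0#
      rest rewrite ++-assoc p (x ∷ y ∷ q) [ w ] = columnExpand-adjacent-pre r rs p (q ++ [ w ]) post (suc k) eq

  columnDet-add : ∀ rs p {q x y} →
    columnDet rs (p ++ (λ r → x r + y r) ∷ q) ≈ columnDet rs (p ++ x ∷ q) + columnDet rs (p ++ y ∷ q)
  columnDet-add rs p = trans
    (columnDet-linear rs p (λ r → +-cong (sym (*-identityˡ _)) (sym (*-identityˡ _))))
    (+-cong (*-identityˡ _) (*-identityˡ _))

  -- Polarization: with `s` the sum of `x` and `y`, expanding the vanishing `d s s` leaves only the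
  -- two mixed terms.
  columnDet-swap : ∀ rs p {q x y} → columnDet rs (p ++ x ∷ y ∷ q) ≈ - columnDet rs (p ++ y ∷ x ∷ q)
  columnDet-swap rs p {q} {x} {y} = +-inverseˡ-unique _ _ (begin
    d x y + d y x                      ≈⟨ +-cong (+-identityˡ _) (+-identityʳ _) ⟨
    (0# + d x y) + (d y x + 0#)        ≈⟨ +-cong (+-congʳ (columnDet-adjacent rs p (λ _ → refl)))
                                                 (+-congˡ (columnDet-adjacent rs p (λ _ → refl))) ⟨
    (d x x + d x y) + (d y x + d y y)  ≈⟨ +-cong (add-second x) (add-second y) ⟨
    d x s + d y s                      ≈⟨ columnDet-add rs p ⟨
    d s s                              ≈⟨ columnDet-adjacent rs p (λ _ → refl) ⟩
    0#                                 ∎)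
    where
    d : Column → Column → Carrier
    d u v = columnDet rs (p ++ u ∷ v ∷ q)
    s : Column
    s r = x r + y r
    add-second : ∀ u → d u s ≈ d u x + d u y
    add-second u rewrite ≡.sym (++-assoc p [ u ] (s ∷ q)) | ≡.sym (++-assoc p [ u ] (x ∷ q))
                       | ≡.sym (++-assoc p [ u ] (y ∷ q)) = columnDet-add rs (p ++ [ u ])

  columnDet-toFront : ∀ rs p m {q x} →
    columnDet rs (p ++ m ++ x ∷ q) ≈ negPow K (length m) * columnDet rs (p ++ x ∷ m ++ q)
  columnDet-toFront rs p []      = sym (*-identityˡ _)
  columnDet-toFront rs p (w ∷ m) {q} {x} = begin
    columnDet rs (p ++ w ∷ m ++ x ∷ q)        ≡⟨ cong (columnDet rs) (++-assoc p [ w ] _) ⟨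
    columnDet rs ((p ++ [ w ]) ++ m ++ x ∷ q) ≈⟨ columnDet-toFront rs (p ++ [ w ]) m ⟩
    s * columnDet rs ((p ++ [ w ]) ++ x ∷ m ++ q)
                                              ≡⟨ cong (λ cs → s * columnDet rs cs) (++-assoc p [ w ] _) ⟩
    s * columnDet rs (p ++ w ∷ x ∷ m ++ q)    ≈⟨ *-congˡ (columnDet-swap rs p) ⟩
    s * - columnDet rs (p ++ x ∷ w ∷ m ++ q)  ≈⟨ trans (sym (-‿distribʳ-* s _)) (-‿distribˡ-* s _) ⟩
    - s * columnDet rs (p ++ x ∷ w ∷ m ++ q)  ∎
    where s = negPow K (length m)

  columnDet-repeated : ∀ rs p m {q x y} → x ≋ y → columnDet rs (p ++ x ∷ m ++ y ∷ q) ≈ 0#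
  columnDet-repeated rs p m {q} {x} {y} eq = begin
    columnDet rs (p ++ x ∷ m ++ y ∷ q)        ≡⟨ cong (columnDet rs) (++-assoc p [ x ] _) ⟨
    columnDet rs ((p ++ [ x ]) ++ m ++ y ∷ q) ≈⟨ columnDet-toFront rs (p ++ [ x ]) m ⟩
    s * columnDet rs ((p ++ [ x ]) ++ y ∷ m ++ q)
                                              ≡⟨ cong (λ cs → s * columnDet rs cs) (++-assoc p [ x ] _) ⟩
    s * columnDet rs (p ++ x ∷ y ∷ m ++ q)    ≈⟨ *-congˡ (columnDet-adjacent rs p eq) ⟩
    s * 0#                                    ≈⟨ zeroʳ s ⟩
    0#                                        ∎
    where s = negPow K (length m)

  negPow-+ : ∀ k l → negPow K (k ℕ.+ l) ≈ negPow K k * negPow K l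
  negPow-+ zero    l = sym (*-identityˡ _)
  negPow-+ (suc k) l = trans (-‿cong (negPow-+ k l)) (-‿distribˡ-* _ _)

  IsUnitAt : Fin n → List (Fin n) → Column → Set ℓ
  IsUnitAt r rs x = x r ≈ 1# × AgreeOn rs x (λ _ → 0#)

  private
    columnExpand-zero-pre : ∀ r rs p {q} post k {x} → AgreeOn rs x (λ _ → 0#) →
                            columnExpand r rs (p ++ x ∷ q) post k ≈ 0#
    columnExpand-zero-pre r rs p     []         k eq = refl
    columnExpand-zero-pre r rs p {q} (w ∷ post) k {x} eq = 0+0 inner rest
      where
      inner : columnDet rs ((p ++ x ∷ q) ++ post) ≈ 0#
      inner rewrite ++-assoc p (x ∷ q) post = columnDet-zero rs p eq
      rest : columnExpand r rs ((p ++ x ∷ q) ++ [ w ]) post (suc k) ≈ 0#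
      rest rewrite ++-assoc p (x ∷ q) [ w ] = columnExpand-zero-pre r rs p post (suc k) eq

  mutual
    -- In a row above `r` the term that picks `x` is zero, and the presence of `x` in front costs
    -- one minus sign. At row `r` itself only the term that picks `x` survives.
    columnDet-strip-front : ∀ rs₁ {r rs₂ x} cs → IsUnitAt r (rs₁ ++ rs₂) x →
      columnDet (rs₁ ++ r ∷ rs₂) (x ∷ cs) ≈ negPow K (length rs₁) * columnDet (rs₁ ++ rs₂) cs
    columnDet-strip-front []         {r} {rs₂} cs (one , zeros) = trans
      (+-cong (*-congʳ (trans (*-identityˡ _) one)) (columnExpand-zero-pre r rs₂ [] cs 1 zeros))
      (+-identityʳ _)
    columnDet-strip-front (r₀ ∷ rs₁) {r} {rs₂} {x} cs (one , zero₀ ∷ zeros) = trans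
      (+-cong (trans (*-congʳ (trans (*-congˡ zero₀) (zeroʳ 1#))) (zeroˡ _))
              (columnExpand-strip-front r₀ rs₁ [] cs 0 (one , zeros)))
      (+-identityˡ _)

    -- The position counter is `suc k` on the left and `k` on the right because `x` occupies the
    -- first place; this shift is the source of the extra sign.
    columnExpand-strip-front : ∀ r₀ rs₁ {r rs₂ x} pre post k → IsUnitAt r (rs₁ ++ rs₂) x →
      columnExpand r₀ (rs₁ ++ r ∷ rs₂) (x ∷ pre) post (suc k)
        ≈ negPow K (suc (length rs₁)) * columnExpand r₀ (rs₁ ++ rs₂) pre post k
    columnExpand-strip-front r₀ rs₁ pre []         k isUnit = sym (zeroʳ _)
    columnExpand-strip-front r₀ rs₁ {r} {rs₂} {x} pre (w ∷ post) k isUnit = begin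
      - t * w r₀ * columnDet (rs₁ ++ r ∷ rs₂) (x ∷ pre ++ post) + rest
        ≈⟨ +-cong (*-congˡ (columnDet-strip-front rs₁ (pre ++ post) isUnit))
                  (columnExpand-strip-front r₀ rs₁ (pre ++ [ w ]) post (suc k) isUnit) ⟩
      - t * w r₀ * (s * d) + - s * rest'
        ≈⟨ +-congʳ (begin
             - t * w r₀ * (s * d)   ≈⟨ scale-swap _ s d ⟩
             s * (- t * w r₀ * d)   ≈⟨ *-congˡ (*-congʳ (-‿distribˡ-* t _)) ⟨
             s * (- (t * w r₀) * d) ≈⟨ *-congˡ (-‿distribˡ-* _ d) ⟨
             s * - (t * w r₀ * d)   ≈⟨ trans (sym (-‿distribʳ-* s _)) (-‿distribˡ-* s _) ⟩
             - s * (t * w r₀ * d)   ∎) ⟩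
      - s * (t * w r₀ * d) + - s * rest'
        ≈⟨ distribˡ (- s) _ _ ⟨
      - s * (t * w r₀ * d + rest') ∎
      where
      s = negPow K (length rs₁)
      t = negPow K k
      d = columnDet (rs₁ ++ rs₂) (pre ++ post)
      rest = columnExpand r₀ (rs₁ ++ r ∷ rs₂) ((x ∷ pre) ++ [ w ]) post (suc (suc k))
      rest' = columnExpand r₀ (rs₁ ++ rs₂) (pre ++ [ w ]) post (suc k)

  columnDet-strip : ∀ rs₁ {r rs₂ x} cs₁ {cs₂} → IsUnitAt r (rs₁ ++ rs₂) x →
    columnDet (rs₁ ++ r ∷ rs₂) (cs₁ ++ x ∷ cs₂)
      ≈ negPow K (length rs₁ ℕ.+ length cs₁) * columnDet (rs₁ ++ rs₂) (cs₁ ++ cs₂)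
  columnDet-strip rs₁ {r} {rs₂} {x} cs₁ {cs₂} isUnit = begin
    columnDet (rs₁ ++ r ∷ rs₂) (cs₁ ++ x ∷ cs₂)     ≈⟨ columnDet-toFront (rs₁ ++ r ∷ rs₂) [] cs₁ ⟩
    t * columnDet (rs₁ ++ r ∷ rs₂) (x ∷ cs₁ ++ cs₂) ≈⟨ *-congˡ (columnDet-strip-front rs₁ (cs₁ ++ cs₂) isUnit) ⟩
    t * (s * d)                                     ≈⟨ scale-swap t s d ⟩
    s * (t * d)                                     ≈⟨ *-assoc s t d ⟨
    s * t * d                                       ≈⟨ *-congʳ (negPow-+ (length rs₁) (length cs₁)) ⟨
    negPow K (length rs₁ ℕ.+ length cs₁) * d        ∎
    where
    s = negPow K (length rs₁)
    t = negPow K (length cs₁)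
    d = columnDet (rs₁ ++ rs₂) (cs₁ ++ cs₂)

-- Indexed families of columns and column operations

module FamilyDeterminant {c ℓ} (K : CommutativeRing c ℓ) {n : ℕ} where
  open CommutativeRing K hiding (zero)
  open RingProperties ring
  open SetoidReasoning setoid
  open Determinant K {n}

  pointwise-tabulate : ∀ {m} {X Y : Fin m → Column} → (∀ v → X v ≋ Y v) →
                       Pointwise _≋_ (tabulate X) (tabulate Y)
  pointwise-tabulate {zero}  eq = []
  pointwise-tabulate {suc m} eq = eq zero ∷ pointwise-tabulate (eq ∘ suc)

  OffAgree : ∀ {m} → Fin m → (X Y : Fin m → Column) → Set ℓ
  OffAgree v X Y = ∀ u → u ≢ v → X u ≋ Y u

  private
    tabulate-linear : ∀ {m} rs p (v : Fin m) {X Y Z : Fin m → Column} {a b} →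
      Combination a b (X v) (Y v) (Z v) → OffAgree v X Z → OffAgree v Y Z →
      columnDet rs (p ++ tabulate Z)
        ≈ a * columnDet rs (p ++ tabulate X) + b * columnDet rs (p ++ tabulate Y)
    tabulate-linear rs p zero    {X} {Y} {Z} {a} {b} eq XZ YZ = trans
      (columnDet-linear rs p eq)
      (sym (+-cong (*-congˡ (move X XZ)) (*-congˡ (move Y YZ))))
      where
      move : ∀ W → OffAgree zero W Z →
        columnDet rs (p ++ tabulate W) ≈ columnDet rs (p ++ W zero ∷ tabulate (Z ∘ suc))
      move W WZ = columnDet-cong rs
        (PW.++⁺ pointwise-refl ((λ _ → refl) ∷ pointwise-tabulate (λ u → WZ (suc u) λ ())))
    tabulate-linear rs p (suc v) {X} {Y} {Z} {a} {b} eq XZ YZ = begin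
      columnDet rs (p ++ tabulate Z)
        ≡⟨ cong (columnDet rs) (++-assoc p [ Z zero ] _) ⟨
      columnDet rs ((p ++ [ Z zero ]) ++ tabulate (Z ∘ suc))
        ≈⟨ tabulate-linear rs (p ++ [ Z zero ]) v eq
             (λ u u≢v → XZ (suc u) (u≢v ∘ Finₚ.suc-injective))
             (λ u u≢v → YZ (suc u) (u≢v ∘ Finₚ.suc-injective)) ⟩
      a * columnDet rs ((p ++ [ Z zero ]) ++ tabulate (X ∘ suc))
        + b * columnDet rs ((p ++ [ Z zero ]) ++ tabulate (Y ∘ suc))
        ≈⟨ +-cong (*-congˡ (move X XZ)) (*-congˡ (move Y YZ)) ⟩
      a * columnDet rs (p ++ tabulate X) + b * columnDet rs (p ++ tabulate Y) ∎
      where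
      move : ∀ W → OffAgree (suc v) W Z →
        columnDet rs ((p ++ [ Z zero ]) ++ tabulate (W ∘ suc)) ≈ columnDet rs (p ++ tabulate W)
      move W WZ = begin
        columnDet rs ((p ++ [ Z zero ]) ++ tabulate (W ∘ suc))
          ≡⟨ cong (columnDet rs) (++-assoc p [ Z zero ] _) ⟩
        columnDet rs (p ++ Z zero ∷ tabulate (W ∘ suc))
          ≈⟨ columnDet-cong rs (PW.++⁺ pointwise-refl ((λ r → sym (WZ zero (λ ()) r)) ∷ pointwise-refl)) ⟩
        columnDet rs (p ++ tabulate W) ∎

    tabulate-repeated-head : ∀ {m} rs p q {x} (v : Fin m) {X : Fin m → Column} → x ≋ X v →
      columnDet rs (p ++ x ∷ q ++ tabulate X) ≈ 0#
    tabulate-repeated-head rs p q         zero    eq = columnDet-repeated rs p q eq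
    tabulate-repeated-head rs p q {x} (suc v) {X} eq = trans
      (reflexive (cong (λ cs → columnDet rs (p ++ x ∷ cs)) (≡.sym (++-assoc q [ X zero ] _))))
      (tabulate-repeated-head rs p (q ++ [ X zero ]) v eq)

    tabulate-repeated : ∀ {m} rs p (u v : Fin m) {X : Fin m → Column} → u ≢ v → X u ≋ X v →
      columnDet rs (p ++ tabulate X) ≈ 0#
    tabulate-repeated rs p zero    zero    u≢v eq = contradiction ≡.refl u≢v
    tabulate-repeated rs p zero    (suc v) u≢v eq = tabulate-repeated-head rs p [] v eq
    tabulate-repeated rs p (suc u) zero    u≢v eq = tabulate-repeated-head rs p [] u (λ r → sym (eq r))
    tabulate-repeated rs p (suc u) (suc v) {X} u≢v eq = trans
      (reflexive (cong (columnDet rs) (≡.sym (++-assoc p [ X zero ] _))))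
      (tabulate-repeated rs (p ++ [ X zero ]) u v (u≢v ∘ cong suc) eq)

  -- Linearity in slot `v` relates three families that agree off `v`, rather than three updates of
  -- one family: families are known only up to pointwise equality, and this form accepts any
  -- presentation of them.
  record Multilinear {m} (Ψ : (Fin m → Column) → Carrier) : Set (c Level.⊔ ℓ) where
    field
      congruent : ∀ {X Y} → (∀ v → X v ≋ Y v) → Ψ X ≈ Ψ Y
      linear    : ∀ v {X Y Z a b} → Combination a b (X v) (Y v) (Z v) →
                  OffAgree v X Z → OffAgree v Y Z → Ψ Z ≈ a * Ψ X + b * Ψ Y

  D : (Fin n → Column) → Carrier
  D X = columnDet (allFin n) (tabulate X)

  D-multilinear : Multilinear D
  D-multilinear = record
    { congruent = λ eq → columnDet-cong (allFin n) (pointwise-tabulate eq)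
    ; linear    = tabulate-linear (allFin n) []
    }

  open Multilinear D-multilinear renaming (congruent to D-cong; linear to D-linear) public

  D-repeated : ∀ {X u v} → u ≢ v → X u ≋ X v → D X ≈ 0#
  D-repeated {u = u} {v} = tabulate-repeated (allFin n) [] u v

  infixl 6 _[_≔_]
  _[_≔_] : ∀ {m} → (Fin m → Column) → Fin m → Column → (Fin m → Column)
  (X [ v ≔ x ]) u with u Finₚ.≟ v
  ... | yes _ = x
  ... | no  _ = X u

  update-at : ∀ {m} (X : Fin m → Column) v x → (X [ v ≔ x ]) v ≋ x
  update-at X v x r with v Finₚ.≟ v
  ... | yes _   = refl
  ... | no v≢v = contradiction ≡.refl v≢v

  update-off : ∀ {m} (X : Fin m → Column) v x u → u ≢ v → (X [ v ≔ x ]) u ≋ X u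
  update-off X v x u u≢v r with u Finₚ.≟ v
  ... | yes u≡v = contradiction u≡v u≢v
  ... | no  _   = refl

  D-addColumn : ∀ {X Z} a u v → u ≢ v → (∀ r → Z v r ≈ X v r + a * X u r) → OffAgree v X Z → D Z ≈ D X
  D-addColumn {X} {Z} a u v u≢v eq XZ = begin
    D Z                     ≈⟨ D-linear v {X} {X [ v ≔ X u ]}
                                 (λ r → trans (eq r) (+-cong (sym (*-identityˡ _))
                                                             (*-congˡ (sym (update-at X v (X u) r)))))
                                 XZ (λ w w≢v r → trans (update-off X v (X u) w w≢v r) (XZ w w≢v r)) ⟩
    1# * D X + a * D (X [ v ≔ X u ])
                            ≈⟨ +-cong (*-identityˡ _) (*-congˡ (D-repeated u≢v
                                 (λ r → trans (update-off X v (X u) u u≢v r) (sym (update-at X v (X u) r))))) ⟩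
    D X + a * 0#            ≈⟨ +-congˡ (zeroʳ a) ⟩
    D X + 0#                ≈⟨ +-identityʳ _ ⟩
    D X                     ∎

  D-dependent : ∀ {X} a b u u' v → u ≢ v → u' ≢ v → Combination a b (X u) (X u') (X v) → D X ≈ 0#
  D-dependent {X} a b u u' v u≢v u'≢v eq = begin
    D X  ≈⟨ D-linear v {X [ v ≔ X u ]} {X [ v ≔ X u' ]}
              (λ r → trans (eq r) (sym (+-cong (*-congˡ (update-at X v (X u) r))
                                               (*-congˡ (update-at X v (X u') r)))))
              (update-off X v (X u)) (update-off X v (X u')) ⟩
    a * D (X [ v ≔ X u ]) + b * D (X [ v ≔ X u' ])
         ≈⟨ +-cong (*-congˡ (vanish u u≢v)) (*-congˡ (vanish u' u'≢v)) ⟩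
    a * 0# + b * 0#  ≈⟨ combine-zero a b ⟨
    0# ∎
    where
    vanish : ∀ w → w ≢ v → D (X [ v ≔ X w ]) ≈ 0#
    vanish w w≢v = D-repeated w≢v
      (λ r → trans (update-off X v (X w) w w≢v r) (sym (update-at X v (X w) r)))

  D-add : ∀ v {X Y Z} → (∀ r → Z v r ≈ X v r + Y v r) → OffAgree v X Z → OffAgree v Y Z →
          D Z ≈ D X + D Y
  D-add v eq XZ YZ = trans
    (D-linear v (λ r → trans (eq r) (sym (+-cong (*-identityˡ _) (*-identityˡ _)))) XZ YZ)
    (+-cong (*-identityˡ _) (*-identityˡ _))

  -- Polarization for slots that need not be adjacent. The sum of `X u` and `X v` in both slots
  -- gives zero; splitting at `u` yields the families of `second-Y` and `second-X`, and in each of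
  -- them splitting at `v` produces one family with a repeated column.
  D-swap : ∀ {X Y u v} → u ≢ v → Y u ≋ X v → Y v ≋ X u →
           (∀ w → w ≢ u → w ≢ v → Y w ≋ X w) → D Y ≈ - D X
  D-swap {X} {Y} {u} {v} u≢v Yu Yv Yw = +-inverseˡ-unique _ _ (begin
    D Y + D X  ≈⟨ +-cong second-Y second-X ⟨
    D (Y [ v ≔ s ]) + D (X [ v ≔ s ])
               ≈⟨ D-add u {Y [ v ≔ s ]} {X [ v ≔ s ]} {S}
                    (λ r → trans (trans (update-at _ u s r) (+-cong (sym (Yu r)) refl))
                                 (sym (+-cong (update-off Y v s u u≢v r) (update-off X v s u u≢v r))))
                    offY offX ⟨
    D S        ≈⟨ D-repeated u≢v (λ r → trans (update-at _ u s r)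
                    (sym (trans (update-off _ u s v (u≢v ∘ ≡.sym) r) (update-at X v s r)))) ⟩
    0#         ∎)
    where
    s : Column
    s r = X v r + X u r
    S : Fin n → Column
    S = X [ v ≔ s ] [ u ≔ s ]
    offX : OffAgree u (X [ v ≔ s ]) S
    offX w w≢u r = sym (update-off _ u s w w≢u r)
    XvY : ∀ w → w ≢ u → (Y [ v ≔ s ]) w ≋ (X [ v ≔ s ]) w
    XvY w w≢u r with w Finₚ.≟ v
    ... | yes _   = refl
    ... | no  w≢v = Yw w w≢u w≢v r
    offY : OffAgree u (Y [ v ≔ s ]) S
    offY w w≢u r = trans (XvY w w≢u r) (offX w w≢u r)
    repeat : ∀ {W x} → W u ≋ x → D (W [ v ≔ x ]) ≈ 0#
    repeat {W} {x} eq = D-repeated u≢v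
      (λ r → trans (update-off W v x u u≢v r) (trans (eq r) (sym (update-at W v x r))))
    second-X : D (X [ v ≔ s ]) ≈ D X
    second-X = trans
      (D-add v {X} {X [ v ≔ X u ]} (λ r → trans (update-at X v s r) (+-congˡ (sym (update-at X v (X u) r))))
        (λ w w≢v r → sym (update-off X v s w w≢v r))
        (λ w w≢v r → trans (update-off X v (X u) w w≢v r) (sym (update-off X v s w w≢v r))))
      (trans (+-congˡ (repeat (λ _ → refl))) (+-identityʳ _))
    second-Y : D (Y [ v ≔ s ]) ≈ D Y
    second-Y = trans
      (D-add v {Y [ v ≔ X v ]} {Y}
        (λ r → trans (update-at Y v s r) (+-cong (sym (update-at Y v (X v) r)) (sym (Yv r))))
        (λ w w≢v r → trans (update-off Y v (X v) w w≢v r) (sym (update-off Y v s w w≢v r)))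
        (λ w w≢v r → sym (update-off Y v s w w≢v r)))
      (trans (+-congʳ (repeat Yu)) (+-identityˡ _))

  -- Replaces the columns one at a time. The hypothesis covers every mixture `Z` in which `v` is
  -- still old, so no order of replacement has to be tracked, but each replacement has to be
  -- justified whichever state the other columns are in.
  D-sweep : ∀ {X Y} →
    (∀ v Z → (∀ u → Z u ≋ X u ⊎ Z u ≋ Y u) → Z v ≋ X v → D (Z [ v ≔ Y v ]) ≈ D Z) → D Y ≈ D X
  D-sweep {X} {Y} replace = trans (D-cong (λ v r → sym (mix-done (∈-allFin v) r))) (mix-D (allFin n))
    where
    mix : List (Fin n) → Fin n → Column
    mix []       = X
    mix (v ∷ vs) = mix vs [ v ≔ Y v ]
    mixture : ∀ vs u → mix vs u ≋ X u ⊎ mix vs u ≋ Y u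
    mixture []       u = inj₁ (λ _ → refl)
    mixture (v ∷ vs) u with u Finₚ.≟ v
    ... | yes ≡.refl = inj₂ (λ _ → refl)
    ... | no  _      = mixture vs u
    mix-done : ∀ {vs v} → v ∈ vs → mix vs v ≋ Y v
    mix-done {w ∷ vs} {v} v∈ r with v Finₚ.≟ w
    mix-done _         r | yes ≡.refl = refl
    mix-done (here eq) r | no v≢w = contradiction eq v≢w
    mix-done (there p) r | no _   = mix-done p r
    mix-D : ∀ vs → D (mix vs) ≈ D X
    mix-D []       = refl
    mix-D (v ∷ vs) with mixture vs v
    ... | inj₁ eq = trans (replace v (mix vs) (mixture vs) eq) (mix-D vs)
    ... | inj₂ eq = trans (D-cong unchanged) (mix-D vs)
      where
      unchanged : ∀ u → (mix vs [ v ≔ Y v ]) u ≋ mix vs u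
      unchanged u r with u Finₚ.≟ v
      ... | yes ≡.refl = sym (eq r)
      ... | no  _      = refl

  basis : Fin n → Column
  basis v r with v Finₚ.≟ r
  ... | yes _ = 1#
  ... | no  _ = 0#

  basis-refl : ∀ v → basis v v ≈ 1#
  basis-refl v with v Finₚ.≟ v
  ... | yes _   = refl
  ... | no v≢v = contradiction ≡.refl v≢v

  basis-≢ : ∀ {v r} → v ≢ r → basis v r ≈ 0#
  basis-≢ {v} {r} v≢r with v Finₚ.≟ r
  ... | yes v≡r = contradiction v≡r v≢r
  ... | no  _   = refl

  D-basis : D basis ≈ 1#
  D-basis = go (λ v → v) (λ eq → eq)
    where
    -- Removing the first row and column leaves an identity matrix on fewer indices, so the
    -- induction runs over injective lists `ι` of indices.
    go : ∀ {m} (ι : Fin m → Fin n) → (∀ {u v} → ι u ≡ ι v → u ≡ v) →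
         columnDet (tabulate ι) (tabulate (basis ∘ ι)) ≈ 1#
    go {zero}  ι inj = refl
    go {suc m} ι inj = trans
      (columnDet-strip [] {ι zero} {tabulate (ι ∘ suc)} {basis (ι zero)} [] {tabulate (basis ∘ ι ∘ suc)}
        (basis-refl (ι zero) , Allₚ.tabulate⁺ (λ v → basis-≢ (λ eq → Finₚ.0≢1+n (inj eq)))))
      (trans (*-identityˡ _) (go (ι ∘ suc) (Finₚ.suc-injective ∘ inj)))

-- Minors as full determinants

increasing-injective : ∀ {p n} {i : Fin p → Fin n} → StrictlyIncreasing i → ∀ {α β} → i α ≡ i β → α ≡ β
increasing-injective inc {α} {β} eq with Finₚ.<-cmp α β
... | tri< α<β _ _ = contradiction eq (Finₚ.<⇒≢ (inc α β α<β))
... | tri≈ _ α≡β _ = α≡β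
... | tri> _ _ β<α = contradiction (≡.sym eq) (Finₚ.<⇒≢ (inc β α β<α))

increasing-tail : ∀ {p n} {i : Fin (suc p) → Fin n} → StrictlyIncreasing i → StrictlyIncreasing (i ∘ suc)
increasing-tail inc α β α<β = inc (suc α) (suc β) (ℕ.s≤s α<β)

allFin-split : ∀ {n} (v : Fin n) → ∃₂ λ l₁ l₂ → allFin n ≡ l₁ ++ v ∷ l₂
  × length l₁ ≡ toℕ v × All (Fin._< v) l₁ × All (v Fin.<_) l₂
allFin-split {suc n} zero    = [] , tabulate suc , ≡.refl , ≡.refl , [] , Allₚ.tabulate⁺ (λ _ → ℕ.s≤s ℕ.z≤n)
allFin-split {suc n} (suc v) with l₁ , l₂ , eq , len , lo , hi ← allFin-split v =
  zero ∷ map suc l₁ , map suc l₂ ,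
  cong (zero ∷_) (≡.trans (≡.sym (map-tabulate (λ w → w) suc)) (≡.trans (cong (map suc) eq) (map-++ suc l₁ (v ∷ l₂)))) ,
  cong suc (≡.trans (length-map suc l₁) len) ,
  ℕ.s≤s ℕ.z≤n ∷ Allₚ.map⁺ (All.map ℕ.s≤s lo) ,
  Allₚ.map⁺ (All.map ℕ.s≤s hi)

filter-congOn : ∀ {a p q} {A : Set a} {P : Pred A p} {Q : Pred A q} (P? : Decidable P) (Q? : Decidable Q) →
  ∀ {xs} → All (λ x → (P x → Q x) × (Q x → P x)) xs → filter P? xs ≡ filter Q? xs
filter-congOn P? Q? []               = ≡.refl
filter-congOn P? Q? {x ∷ xs} ((f , g) ∷ eqs) with P? x
... | yes px = ≡.trans (cong (x ∷_) (filter-congOn P? Q? eqs)) (≡.sym (filter-accept Q? (f px)))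
... | no ¬px = ≡.trans (filter-congOn P? Q? eqs) (≡.sym (filter-reject Q? (¬px ∘ g)))

module _ {p n} (i : Fin (suc p) → Fin n) (inc : StrictlyIncreasing i) where

  -- `i zero` is the least element of I. Dropping it from I returns it to the complement right after
  -- the indices smaller than it, none of which lies in I; hence its position there is
  -- `toℕ (i zero)`, the exponent needed for the Laplace sign.
  complement-split : ∃₂ λ l₁ l₂ → complement (i ∘ suc) ≡ l₁ ++ i zero ∷ l₂ × complement i ≡ l₁ ++ l₂
    × length l₁ ≡ toℕ (i zero) × All (_≢ i zero) (l₁ ++ l₂)
  complement-split with l₁ , l₂ , eq , len , lo , hi ← allFin-split (i zero) =
    l₁ , filter tail? l₂ ,
    ≡.trans (cong (filter tail?) eq) (≡.trans (filter-++ tail? l₁ (i zero ∷ l₂))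
      (≡.cong₂ _++_ (filter-all tail? (All.map tail-lo lo)) (filter-accept tail? zero-kept))) ,
    ≡.trans (cong (filter all?) eq) (≡.trans (filter-++ all? l₁ (i zero ∷ l₂))
      (≡.cong₂ _++_ (filter-all all? (All.map all-lo lo))
        (≡.trans (filter-reject all? (λ k → k (zero , ≡.refl))) (filter-congOn all? tail? (All.map agree hi))))) ,
    len ,
    Allₚ.++⁺ (All.map Finₚ.<⇒≢ lo) (Allₚ.filter⁺ tail? (All.map (λ lt → Finₚ.<⇒≢ lt ∘ ≡.sym) hi))
    where
    all? = λ x → ¬? (any? (λ α → i α Fin.≟ x))
    tail? = λ x → ¬? (any? (λ α → i (suc α) Fin.≟ x))
    zero≤ : ∀ α → i zero Fin.≤ i α
    zero≤ zero    = Finₚ.≤-refl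
    zero≤ (suc α) = ℕₚ.<⇒≤ (inc zero (suc α) (ℕ.s≤s ℕ.z≤n))
    all-lo : ∀ {x} → x Fin.< i zero → ¬ (∃ λ α → i α ≡ x)
    all-lo x<i (α , ≡.refl) = ℕₚ.<⇒≱ x<i (zero≤ α)
    tail-lo : ∀ {x} → x Fin.< i zero → ¬ (∃ λ α → i (suc α) ≡ x)
    tail-lo x<i (α , eq) = all-lo x<i (suc α , eq)
    zero-kept : ¬ (∃ λ α → i (suc α) ≡ i zero)
    zero-kept (α , eq) with () ← increasing-injective inc {suc α} {zero} eq
    agree : ∀ {x} → i zero Fin.< x →
      (¬ (∃ λ α → i α ≡ x) → ¬ (∃ λ α → i (suc α) ≡ x)) ×
      (¬ (∃ λ α → i (suc α) ≡ x) → ¬ (∃ λ α → i α ≡ x))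
    agree lt = (λ k (α , eq) → k (suc α , eq)) ,
      λ { k (zero , eq) → Finₚ.<⇒≢ lt eq ; k (suc α , eq) → k (α , eq) }

complement-empty : ∀ {n} (i : Fin 0 → Fin n) → complement i ≡ allFin n
complement-empty {n} i = filter-all (λ x → ¬? (any? (λ α → i α Fin.≟ x))) (All.universal (λ { _ (() , _) }) (allFin n))

length-complement : ∀ {p n} (i : Fin p → Fin n) → StrictlyIncreasing i → length (complement i) ℕ.+ p ≡ n
length-complement {zero}  i inc =
  ≡.trans (ℕₚ.+-identityʳ _) (≡.trans (cong length (complement-empty i)) (length-tabulate (λ v → v)))
length-complement {suc p} i inc with l₁ , l₂ , eq , eq' , _ ← complement-split i inc =
  ≡.trans (≡.trans (cong (λ l → length l ℕ.+ suc p) eq') (ℕₚ.+-suc (length (l₁ ++ l₂)) p))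
  (≡.trans (cong (ℕ._+ p) (≡.sym (≡.trans (cong length eq) (≡.trans (length-++ l₁)
     (≡.trans (ℕₚ.+-suc (length l₁) (length l₂)) (cong suc (≡.sym (length-++ l₁))))))))
   (length-complement (i ∘ suc) (increasing-tail inc)))

indexSum-suc : ∀ {p n} (i : Fin (suc p) → Fin n) → indexSum i ≡ suc (toℕ (i zero)) ℕ.+ indexSum (i ∘ suc)
indexSum-suc i = cong (λ l → suc (toℕ (i zero)) ℕ.+ sum l)
  (≡.trans (map-tabulate Fin.suc (λ α → suc (toℕ (i α)))) (≡.sym (map-tabulate (λ α → α) (λ α → suc (toℕ (i (suc α)))))))

module MinorAsDeterminant {c ℓ} (K : CommutativeRing c ℓ) {n : ℕ} where
  open CommutativeRing K hiding (zero)
  open RingProperties ring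
  open SetoidReasoning setoid
  open Determinant K {n}
  open FamilyDeterminant K {n}

  negPow-square : ∀ k → negPow K k * negPow K k ≈ 1#
  negPow-square zero    = *-identityˡ 1#
  negPow-square (suc k) = begin
    - s * - s     ≈⟨ -‿distribˡ-* s (- s) ⟨
    - (s * - s)   ≈⟨ -‿cong (-‿distribʳ-* s s) ⟨
    - - (s * s)   ≈⟨ -‿involutive _ ⟩
    s * s         ≈⟨ negPow-square k ⟩
    1#            ∎
    where s = negPow K k

  -- Recursive in the order in which `columnDet-complement` reinserts rows and columns;
  -- `replaceColumns-at` and `replaceColumns-off` recover the direct description.
  replaceColumns : ∀ {p} → (i j : Fin p → Fin n) → (Fin n → Column) → (Fin n → Column)
  replaceColumns {zero}  i j X = X
  replaceColumns {suc p} i j X = replaceColumns (i ∘ suc) (j ∘ suc) (X [ j zero ≔ basis (i zero) ])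

  replaceColumns-off : ∀ {p} (i j : Fin p → Fin n) X v → (∀ α → j α ≢ v) → replaceColumns i j X v ≋ X v
  replaceColumns-off {zero}  i j X v v∉j r = refl
  replaceColumns-off {suc p} i j X v v∉j r = trans
    (replaceColumns-off (i ∘ suc) (j ∘ suc) _ v (v∉j ∘ suc) r)
    (update-off X (j zero) _ v (v∉j zero ∘ ≡.sym) r)

  replaceColumns-at : ∀ {p} (i j : Fin p → Fin n) X → (∀ {α β} → j α ≡ j β → α ≡ β) → ∀ α →
                      replaceColumns i j X (j α) ≋ basis (i α)
  replaceColumns-at i j X inj zero    r = trans
    (replaceColumns-off (i ∘ suc) (j ∘ suc) _ (j zero) (λ β eq → Finₚ.0≢1+n (≡.sym (inj eq))) r)
    (update-at X (j zero) _ r)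
  replaceColumns-at i j X inj (suc α) r =
    replaceColumns-at (i ∘ suc) (j ∘ suc) _ (Finₚ.suc-injective ∘ inj) α r

  private
    pointwise-map : ∀ {X Y : Fin n → Column} {vs} → All (λ v → X v ≋ Y v) vs → Pointwise _≋_ (map X vs) (map Y vs)
    pointwise-map []         = []
    pointwise-map (eq ∷ eqs) = eq ∷ pointwise-map eqs

  -- Induction on the number of deleted pairs. Reinserting row `i zero` and column `j zero`, filled
  -- with the basis vector at `i zero`, changes the minor by a sign, by `columnDet-strip`; the other
  -- deletions are undone by the induction hypothesis for the modified columns.
  columnDet-complement : ∀ {p} (i j : Fin p → Fin n) → StrictlyIncreasing i → StrictlyIncreasing j → ∀ X →
    columnDet (complement i) (map X (complement j))
      ≈ negPow K (indexSum i ℕ.+ indexSum j) * D (replaceColumns i j X)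
  columnDet-complement {zero}  i j inc-i inc-j X = trans
    (reflexive (≡.cong₂ columnDet (complement-empty i)
      (≡.trans (cong (map X) (complement-empty j)) (map-tabulate (λ v → v) X))))
    (sym (*-identityˡ _))
  columnDet-complement {suc p} i j inc-i inc-j X
    with r₁ , r₂ , full-i , compl-i , len-i , r≢ ← complement-split i inc-i
       | c₁ , c₂ , full-j , compl-j , len-j , c≢ ← complement-split j inc-j = begin
    columnDet (complement i) (map X (complement j))
      ≡⟨ ≡.cong₂ columnDet compl-i (≡.trans (cong (map X) compl-j) (map-++ X c₁ c₂)) ⟩
    d                ≈⟨ *-identityˡ d ⟨
    -- Stripping expresses the larger determinant by the smaller one; inserting the sign squared
    -- reverses this.
    1# * d           ≈⟨ *-congʳ (negPow-square (a ℕ.+ b)) ⟨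
    (s * s) * d      ≈⟨ *-assoc s s d ⟩
    s * (s * d)      ≈⟨ *-congˡ strip ⟨
    s * columnDet (complement (i ∘ suc)) (map X' (complement (j ∘ suc)))
      ≈⟨ *-congˡ (columnDet-complement (i ∘ suc) (j ∘ suc) (increasing-tail inc-i) (increasing-tail inc-j) X') ⟩
    s * (negPow K (S ℕ.+ T) * E)    ≈⟨ *-assoc s _ E ⟨
    s * negPow K (S ℕ.+ T) * E      ≈⟨ *-congʳ (negPow-+ (a ℕ.+ b) (S ℕ.+ T)) ⟨
    -- `toℕ` counts from 0 and `indexSum` from 1, so the row and the column each add 1 to the
    -- exponent; the two signs cancel.
    negPow K (a ℕ.+ b ℕ.+ (S ℕ.+ T)) * E  ≈⟨ *-congʳ (-‿involutive _) ⟨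
    negPow K (2 ℕ.+ (a ℕ.+ b ℕ.+ (S ℕ.+ T))) * E ≡⟨ cong (λ k → negPow K k * E) exponent ⟨
    negPow K (indexSum i ℕ.+ indexSum j) * E ∎
    where
    a = toℕ (i zero)
    b = toℕ (j zero)
    S = indexSum (i ∘ suc)
    T = indexSum (j ∘ suc)
    X' = X [ j zero ≔ basis (i zero) ]
    E = D (replaceColumns (i ∘ suc) (j ∘ suc) X')
    s = negPow K (a ℕ.+ b)
    d = columnDet (r₁ ++ r₂) (map X c₁ ++ map X c₂)
    exponent : indexSum i ℕ.+ indexSum j ≡ 2 ℕ.+ (a ℕ.+ b ℕ.+ (S ℕ.+ T))
    exponent = ≡.trans (≡.cong₂ ℕ._+_ (indexSum-suc i) (indexSum-suc j))
      (solve 4 (λ a b S T → (con 1 :+ a :+ S) :+ (con 1 :+ b :+ T) := con 2 :+ (a :+ b :+ (S :+ T))) ≡.refl a b S T)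
      where open +-*-Solver
    off : ∀ {v} → v ≢ j zero → X' v ≋ X v
    off = update-off X (j zero) _ _
    strip : columnDet (complement (i ∘ suc)) (map X' (complement (j ∘ suc))) ≈ s * d
    strip = begin
      columnDet (complement (i ∘ suc)) (map X' (complement (j ∘ suc)))
        ≡⟨ ≡.cong₂ columnDet full-i (≡.trans (cong (map X') full-j) (map-++ X' c₁ (j zero ∷ c₂))) ⟩
      columnDet (r₁ ++ i zero ∷ r₂) (map X' c₁ ++ X' (j zero) ∷ map X' c₂)
        ≈⟨ columnDet-cong (r₁ ++ i zero ∷ r₂) (PW.++⁺ (pointwise-map (All.map off (Allₚ.++⁻ˡ c₁ c≢)))
             (update-at X (j zero) (basis (i zero)) ∷ pointwise-map (All.map off (Allₚ.++⁻ʳ c₁ c≢)))) ⟩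
      columnDet (r₁ ++ i zero ∷ r₂) (map X c₁ ++ basis (i zero) ∷ map X c₂)
        ≈⟨ columnDet-strip r₁ (map X c₁)
             (basis-refl (i zero) , All.map (λ r≢i → basis-≢ (r≢i ∘ ≡.sym)) r≢) ⟩
      negPow K (length r₁ ℕ.+ length (map X c₁)) * d
        ≡⟨ cong (λ k → negPow K k * d) (≡.cong₂ ℕ._+_ len-i (≡.trans (length-map X c₁) len-j)) ⟩
      s * d ∎

  minor≈D : ∀ {p} (A : Fin n → Fin n → Carrier) (i j : Fin p → Fin n) → StrictlyIncreasing i → StrictlyIncreasing j →
    minor K A i j ≈ negPow K (indexSum i ℕ.+ indexSum j) * D (replaceColumns i j (column A))
  minor≈D {p} A i j inc-i inc-j = trans
    (reflexive (det≡columnDet A (complement i) (complement j)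
      (ℕₚ.+-cancelʳ-≡ p _ _ (≡.trans (length-complement i inc-i) (≡.sym (length-complement j inc-j))))))
    (columnDet-complement i j inc-i inc-j (column A))

-- Signatures

-- A missed value could be punched out, giving an injection of `Fin (suc m)` into `Fin m`.
injective⇒surjective : ∀ {m} (f : Fin m → Fin m) → (∀ {x y} → f x ≡ f y → x ≡ y) → ∀ y → ∃ λ x → f x ≡ y
injective⇒surjective {suc m} f inj y with any? (λ x → f x Finₚ.≟ y)
... | yes hit = hit
... | no miss = contradiction (Finₚ.injective⇒≤ {f = f'} inj') ℕₚ.1+n≰n
  where
  y≢f : ∀ x → y ≢ f x
  y≢f x eq = miss (x , ≡.sym eq)
  f' : Fin (suc m) → Fin m
  f' x = punchOut (y≢f x)
  inj' : ∀ {x x'} → f' x ≡ f' x' → x ≡ x'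
  inj' = inj ∘ Finₚ.punchOut-injective (y≢f _) (y≢f _)

unique-↭ : ∀ {a} {A : Set a} {xs ys : List A} → Unique xs → Unique ys →
           (∀ {x} → x ∈ xs → x ∈ ys) → (∀ {x} → x ∈ ys → x ∈ xs) → xs ↭ ys
unique-↭ u v f g = ∼bag⇒↭ (unique∧set⇒bag u v (mk⇔ f g))

injective-↭ : ∀ {m} (f : Fin m → Fin m) → (∀ {x y} → f x ≡ f y → x ≡ y) → map f (allFin m) ↭ allFin m
injective-↭ {m} f inj = unique-↭ (Uniqueₚ.map⁺ inj (Uniqueₚ.allFin⁺ m)) (Uniqueₚ.allFin⁺ m)
  (λ _ → ∈-allFin _) surj
  where
  surj : ∀ {y} → y ∈ allFin m → y ∈ map f (allFin m)
  surj {y} _ with x , ≡.refl ← injective⇒surjective f inj y = ∈-map⁺ f (∈-allFin x)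

allFin-suc : ∀ m → allFin (suc m) ≡ zero ∷ map suc (allFin m)
allFin-suc m = cong (zero ∷_) (≡.sym (map-tabulate (λ α → α) suc))

module _ {a q} {A : Set a} {Q : Pred A q} (Q? : Decidable Q) where
  length-filter-map : ∀ {b} {B : Set b} (f : B → A) xs → length (filter Q? (map f xs)) ≡ length (filter (Q? ∘ f) xs)
  length-filter-map f []       = ≡.refl
  length-filter-map f (x ∷ xs) with Q? (f x)
  ... | yes _ = cong suc (length-filter-map f xs)
  ... | no  _ = length-filter-map f xs

length-filter-product : ∀ {a b q} {A : Set a} {B : Set b} {Q : Pred (A × B) q} (Q? : Decidable Q) xs ys →
  length (filter Q? (cartesianProduct xs ys)) ≡ sum (map (λ x → length (filter (λ y → Q? (x , y)) ys)) xs)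
length-filter-product Q? []       ys = ≡.refl
length-filter-product Q? (x ∷ xs) ys = ≡.trans
  (≡.trans (cong length (filter-++ Q? (map (x ,_) ys) (cartesianProduct xs ys))) (length-++ (filter Q? (map (x ,_) ys))))
  (≡.cong₂ ℕ._+_ (length-filter-map Q? (x ,_) ys) (length-filter-product Q? xs ys))

count-below : ∀ {m} (s : Fin m) → length (filter (Fin._<? s) (allFin m)) ≡ toℕ s
count-below {suc m} zero    = cong length (filter-none (Fin._<? zero {m}) (All.universal (λ _ ()) (allFin (suc m))))
count-below {suc m} (suc s) = ≡.trans (cong (length ∘ filter (Fin._<? suc s)) (allFin-suc m))
  (≡.trans (cong length (filter-accept (Fin._<? suc s) {zero} {map suc (allFin m)} (ℕ.s≤s ℕ.z≤n)))
   (cong suc (≡.trans (length-filter-map (Fin._<? suc s) suc (allFin m))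
     (≡.trans (cong length (filter-congOn (λ b → suc b Fin.<? suc s) (Fin._<? s)
        (All.universal (λ _ → ℕ.s<s⁻¹ , ℕ.s<s) (allFin m)))) (count-below s)))))

module _ {p} (s : Fin (suc p)) (σ : Vec (Fin (suc p)) p)
         (inj : ∀ {α β} → lookup (s ∷ σ) α ≡ lookup (s ∷ σ) β → α ≡ β) where

  head≢tail : ∀ b → s ≢ lookup σ b
  head≢tail b eq = Finₚ.0≢1+n (inj {zero} {suc b} eq)

  -- Standardization of the tail: values above `s` drop by one, which preserves all comparisons.
  reduced : Vec (Fin p) p
  reduced = Vec.tabulate (λ b → punchOut (head≢tail b))

  lookup-reduced : ∀ b → lookup reduced b ≡ punchOut (head≢tail b)
  lookup-reduced = lookup∘tabulate _

  punchIn-reduced : ∀ b → punchIn s (lookup reduced b) ≡ lookup σ b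
  punchIn-reduced b = ≡.trans (cong (punchIn s) (lookup-reduced b)) (Finₚ.punchIn-punchOut (head≢tail b))

  reduced-injective : ∀ {α β} → lookup reduced α ≡ lookup reduced β → α ≡ β
  reduced-injective {α} {β} eq = Finₚ.suc-injective (inj (≡.trans (≡.sym (punchIn-reduced α))
    (≡.trans (cong (punchIn s) eq) (punchIn-reduced β))))

  private
    reduced-< : ∀ a b → (lookup σ b Fin.< lookup σ a → lookup reduced b Fin.< lookup reduced a)
                      × (lookup reduced b Fin.< lookup reduced a → lookup σ b Fin.< lookup σ a)
    reduced-< a b rewrite lookup-reduced a | lookup-reduced b =
      (λ lt → ℕₚ.≰⇒> (λ le → ℕₚ.<⇒≱ lt (Finₚ.punchOut-cancel-≤ (head≢tail a) (head≢tail b) le))) ,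
      (λ lt → ℕₚ.≰⇒> (λ le → ℕₚ.<⇒≱ lt (Finₚ.punchOut-mono-≤ (head≢tail a) (head≢tail b) le)))

    head-row : length (filter (λ b → lookup σ b Fin.<? s) (allFin p)) ≡ toℕ s
    head-row = begin
      length (filter (λ b → lookup σ b Fin.<? s) (allFin p))
        ≡⟨ length-filter-map (Fin._<? s) (lookup σ) (allFin p) ⟨
      length (filter (Fin._<? s) (map (lookup σ) (allFin p)))
        -- Prepending `s` keeps the count, as `s` is not below itself, and makes the list a
        -- rearrangement of all of `Fin (suc p)`.
        ≡⟨ cong length (filter-reject (Fin._<? s) {s} {map (lookup σ) (allFin p)} (ℕₚ.<-irrefl ≡.refl)) ⟨
      length (filter (Fin._<? s) (s ∷ map (lookup σ) (allFin p)))
        ≡⟨ cong (length ∘ filter (Fin._<? s)) (≡.trans (cong (map (lookup (s ∷ σ))) (allFin-suc p))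
              (cong (s ∷_) (≡.sym (map-∘ (allFin p))))) ⟨
      length (filter (Fin._<? s) (map (lookup (s ∷ σ)) (allFin (suc p))))
        ≡⟨ ↭-length (filter-↭ (Fin._<? s) (injective-↭ (lookup (s ∷ σ)) inj)) ⟩
      length (filter (Fin._<? s) (allFin (suc p)))
        ≡⟨ count-below s ⟩
      toℕ s ∎
      where open ≡.≡-Reasoning

  -- One step of the Lehmer code. All `toℕ s` values below `s` stand after position 0, so that
  -- position takes part in exactly that many inversions; the rest are those of the standardized
  -- tail.
  inversions-cons : inversions (s ∷ σ) ≡ toℕ s ℕ.+ inversions reduced
  inversions-cons = begin
    inversions (s ∷ σ)
      ≡⟨ length-filter-product Q? (allFin (suc p)) (allFin (suc p)) ⟩
    sum (map row (allFin (suc p)))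
      ≡⟨ cong (sum ∘ map row) (allFin-suc p) ⟩
    row zero ℕ.+ sum (map row (map suc (allFin p)))
      ≡⟨ ≡.cong₂ ℕ._+_ (≡.trans (row-tail zero) (≡.trans (cong length (filter-congOn
            (λ b → Q? (zero , suc b)) (λ b → lookup σ b Fin.<? s)
            (All.universal (λ _ → proj₂ , (λ lt → ℕ.s≤s ℕ.z≤n , lt)) (allFin p)))) head-row))
          (cong sum (≡.trans (≡.sym (map-∘ (allFin p))) (map-cong row-suc (allFin p)))) ⟩
    toℕ s ℕ.+ sum (map row' (allFin p))
      ≡⟨ cong (toℕ s ℕ.+_) (length-filter-product Q'? (allFin p) (allFin p)) ⟨
    toℕ s ℕ.+ inversions reduced ∎
    where
    open ≡.≡-Reasoning
    Q? = λ (ab : Fin (suc p) × Fin (suc p)) →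
      (proj₁ ab Fin.<? proj₂ ab) ×-dec (lookup (s ∷ σ) (proj₂ ab) Fin.<? lookup (s ∷ σ) (proj₁ ab))
    Q'? = λ (ab : Fin p × Fin p) →
      (proj₁ ab Fin.<? proj₂ ab) ×-dec (lookup reduced (proj₂ ab) Fin.<? lookup reduced (proj₁ ab))
    row : Fin (suc p) → ℕ
    row a = length (filter (λ b → Q? (a , b)) (allFin (suc p)))
    row' : Fin p → ℕ
    row' a = length (filter (λ b → Q'? (a , b)) (allFin p))
    row-tail : ∀ a → row a ≡ length (filter (λ b → Q? (a , suc b)) (allFin p))
    row-tail a = ≡.trans (cong (length ∘ filter (λ b → Q? (a , b))) (allFin-suc p))
      (≡.trans (cong length (filter-reject (λ b → Q? (a , b)) {zero} {map suc (allFin p)} (λ { (() , _) })))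
        (length-filter-map (λ b → Q? (a , b)) suc (allFin p)))
    row-suc : ∀ a → row (suc a) ≡ row' a
    row-suc a = ≡.trans (row-tail (suc a)) (cong length (filter-congOn
      (λ b → Q? (suc a , suc b)) (λ b → Q'? (a , b))
      (All.universal (λ b → (λ (lt , inv) → ℕ.s<s⁻¹ lt , proj₁ (reduced-< a b) inv)
                          , (λ (lt , inv) → ℕ.s<s lt , proj₂ (reduced-< a b) inv)) (allFin p))))

infixr 5 _◃_
_◃_ : ∀ {a m} {A : Set a} → A → (Fin m → A) → (Fin (suc m) → A)
(x ◃ f) zero    = x
(x ◃ f) (suc v) = f v

module Signature {c ℓ} (K : CommutativeRing c ℓ) {W : Set} where
  open CommutativeRing K hiding (zero)
  open RingProperties ring
  open SetoidReasoning setoid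
  open Determinant K {0} using (negPow-+)

  -- The arguments are labels instead of columns: later, the vertices whose basis vectors fill the
  -- slots in J. An exchange is described by its values, since functions are available only up to
  -- pointwise equality.
  record Antisymmetric {p} (Φ : (Fin p → W) → Carrier) : Set ℓ where
    field
      congruent : ∀ {w w'} → (∀ α → w α ≡ w' α) → Φ w ≈ Φ w'
      swap      : ∀ {w w'} α β → α ≢ β → w' α ≡ w β → w' β ≡ w α →
                  (∀ γ → γ ≢ α → γ ≢ β → w' γ ≡ w γ) → Φ w' ≈ - Φ w
  open Antisymmetric

  antisymmetric-◃ : ∀ {p} {Φ : (Fin (suc p) → W) → Carrier} → Antisymmetric Φ → ∀ x →
                    Antisymmetric (λ w → Φ (x ◃ w))
  antisymmetric-◃ anti x = record
    { congruent = λ eq → congruent anti λ { zero → ≡.refl ; (suc α) → eq α }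
    ; swap      = λ α β α≢β eqα eqβ off → swap anti (suc α) (suc β) (α≢β ∘ Finₚ.suc-injective) eqα eqβ
        λ { zero _ _ → ≡.refl ; (suc γ) γ≢α γ≢β → off γ (γ≢α ∘ cong suc) (γ≢β ∘ cong suc) }
    }

  antisymmetric-toFront : ∀ {p} {Φ : (Fin (suc p) → W) → Carrier} → Antisymmetric Φ → ∀ w s →
    Φ (w s ◃ (w ∘ punchIn s)) ≈ negPow K (toℕ s) * Φ w
  antisymmetric-toFront {_}     anti w zero    = trans
    (congruent anti λ { zero → ≡.refl ; (suc α) → ≡.refl }) (sym (*-identityˡ _))
  antisymmetric-toFront {suc p} {Φ} anti w (suc s) = begin
    Φ (w (suc s) ◃ (w ∘ punchIn (suc s)))
      ≈⟨ swap anti zero (suc zero) (λ ()) ≡.refl ≡.refl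
           (λ { zero γ≢0 _ → contradiction ≡.refl γ≢0
              ; (suc zero) _ γ≢1 → contradiction ≡.refl γ≢1
              ; (suc (suc γ)) _ _ → ≡.refl }) ⟩
    - Φ (w zero ◃ w (suc s) ◃ (w ∘ suc ∘ punchIn s))
      ≈⟨ -‿cong (antisymmetric-toFront (antisymmetric-◃ anti (w zero)) (w ∘ suc) s) ⟩
    - (negPow K (toℕ s) * Φ (w zero ◃ (w ∘ suc)))
      ≈⟨ -‿cong (*-congˡ (congruent anti λ { zero → ≡.refl ; (suc α) → ≡.refl })) ⟩
    - (negPow K (toℕ s) * Φ w)
      ≈⟨ -‿distribˡ-* _ _ ⟩
    - negPow K (toℕ s) * Φ w ∎

  -- Follows the recursion of `inversions-cons`: `w s` is brought to the front at the cost of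
  -- `toℕ s` signs, and the remaining labels are permuted by the standardized tail.
  antisymmetric-permute : ∀ {p} {Φ : (Fin p → W) → Carrier} → Antisymmetric Φ → ∀ w (σ : Vec (Fin p) p) →
    (∀ {α β} → lookup σ α ≡ lookup σ β → α ≡ β) → Φ (w ∘ lookup σ) ≈ signature K σ * Φ w
  antisymmetric-permute {zero}  anti w []      inj = trans (congruent anti λ ()) (sym (*-identityˡ _))
  antisymmetric-permute {suc p} {Φ} anti w (s ∷ σ) inj = begin
    Φ (w ∘ lookup (s ∷ σ))
      ≈⟨ congruent anti (λ { zero → ≡.refl ; (suc α) → cong w (≡.sym (punchIn-reduced s σ inj α)) }) ⟩
    Φ (w s ◃ (w ∘ punchIn s ∘ lookup σ'))
      ≈⟨ antisymmetric-permute (antisymmetric-◃ anti (w s)) (w ∘ punchIn s) σ' (reduced-injective s σ inj) ⟩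
    signature K σ' * Φ (w s ◃ (w ∘ punchIn s))
      ≈⟨ *-congˡ (antisymmetric-toFront anti w s) ⟩
    signature K σ' * (negPow K (toℕ s) * Φ w)
      ≈⟨ *-assoc _ _ _ ⟨
    signature K σ' * negPow K (toℕ s) * Φ w
      ≈⟨ *-congʳ (trans (*-comm _ _) (sym (negPow-+ (toℕ s) (inversions σ')))) ⟩
    negPow K (toℕ s ℕ.+ inversions σ') * Φ w
      ≡⟨ cong (λ k → negPow K k * Φ w) (inversions-cons s σ inj) ⟨
    signature K (s ∷ σ) * Φ w ∎
    where σ' = reduced s σ inj

-- Multilinear expansion

vecs : ∀ {a} {X : Set a} m → (Fin m → List X) → List (Vec X m)
vecs zero    os = [] ∷ []
vecs (suc m) os = cartesianProductWith _∷_ (os zero) (vecs m (os ∘ suc))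

module Expansion {c ℓ} (K : CommutativeRing c ℓ) {n : ℕ} where
  open CommutativeRing K hiding (zero)
  open RingProperties ring
  open SetoidReasoning setoid
  open Determinant K {n}
  open FamilyDeterminant K {n}
  open Multilinear

  ∑ : ∀ {a} {X : Set a} → List X → (X → Carrier) → Carrier
  ∑ xs f = sumL K (map f xs)

  module _ {a} {X : Set a} where
    ∑-cong : ∀ {f g : X → Carrier} xs → (∀ x → f x ≈ g x) → ∑ xs f ≈ ∑ xs g
    ∑-cong []       eq = refl
    ∑-cong (x ∷ xs) eq = +-cong (eq x) (∑-cong xs eq)

    ∑-distribˡ : ∀ s (f : X → Carrier) xs → s * ∑ xs f ≈ ∑ xs (λ x → s * f x)
    ∑-distribˡ s f []       = zeroʳ s
    ∑-distribˡ s f (x ∷ xs) = trans (distribˡ s _ _) (+-congˡ (∑-distribˡ s f xs))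

    ∑-++ : ∀ (f : X → Carrier) xs ys → ∑ (xs ++ ys) f ≈ ∑ xs f + ∑ ys f
    ∑-++ f []       ys = sym (+-identityˡ _)
    ∑-++ f (x ∷ xs) ys = trans (+-congˡ (∑-++ f xs ys)) (sym (+-assoc _ _ _))

  ∑-map : ∀ {a b} {X : Set a} {Y : Set b} (f : Y → Carrier) (g : X → Y) xs → ∑ (map g xs) f ≈ ∑ xs (f ∘ g)
  ∑-map f g xs = reflexive (cong (sumL K) (≡.sym (map-∘ xs)))

  ∑-product : ∀ {a b d} {X : Set a} {Y : Set b} {Z : Set d} (h : Z → Carrier) (g : X → Y → Z) xs ys →
    ∑ (cartesianProductWith g xs ys) h ≈ ∑ xs (λ x → ∑ ys (λ y → h (g x y)))
  ∑-product h g []       ys = refl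
  ∑-product h g (x ∷ xs) ys = trans (∑-++ h (map (g x) ys) _)
    (+-cong (∑-map h (g x) ys) (∑-product h g xs ys))

  -- Linearity splits a column into two parts only, so the sum is peeled off term by term, `rest`
  -- holding the part not yet treated.
  multilinear-∑ : ∀ {a} {X : Set a} {m} {Ψ : (Fin m → Column) → Carrier} → Multilinear Ψ →
    ∀ v {Z} (w : X → Carrier) (Y : X → Fin m → Column) xs → (∀ x → OffAgree v (Y x) Z) →
    (∀ r → Z v r ≈ ∑ xs (λ x → w x * Y x v r)) → Ψ Z ≈ ∑ xs (λ x → w x * Ψ (Y x))
  multilinear-∑ {Ψ = Ψ} ml v {Z} w Y [] off eq = begin
    Ψ Z                   ≈⟨ linear ml v {Z} {Z} {Z} {0#} {0#} (λ r → trans (eq r)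
                               (sym (trans (+-cong (zeroˡ _) (zeroˡ _)) (+-identityˡ 0#))))
                               (λ _ _ _ → refl) (λ _ _ _ → refl) ⟩
    0# * Ψ Z + 0# * Ψ Z   ≈⟨ trans (+-cong (zeroˡ _) (zeroˡ _)) (+-identityˡ 0#) ⟩
    0#                    ∎
  multilinear-∑ {Ψ = Ψ} ml v {Z} w Y (x ∷ xs) off eq = begin
    Ψ Z  ≈⟨ linear ml v {Y x} {Z'} {Z} (λ r → trans (eq r)
              (+-congˡ (sym (trans (*-identityˡ _) (update-at Z v rest r)))))
              (off x) (update-off Z v rest) ⟩
    w x * Ψ (Y x) + 1# * Ψ Z'  ≈⟨ +-congˡ (*-identityˡ _) ⟩
    w x * Ψ (Y x) + Ψ Z'
         ≈⟨ +-congˡ (multilinear-∑ ml v w Y xs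
              (λ y u u≢v r → trans (off y u u≢v r) (sym (update-off Z v rest u u≢v r)))
              (update-at Z v rest)) ⟩
    w x * Ψ (Y x) + ∑ xs (λ y → w y * Ψ (Y y)) ∎
    where
    rest : Column
    rest r = ∑ xs (λ y → w y * Y y v r)
    Z' = Z [ v ≔ rest ]

  multilinear-◃ : ∀ {m} {Ψ : (Fin (suc m) → Column) → Carrier} → Multilinear Ψ → ∀ x → Multilinear (λ X → Ψ (x ◃ X))
  multilinear-◃ ml x = record
    { congruent = λ eq → congruent ml λ { zero r → refl ; (suc v) → eq v }
    ; linear    = λ v eq XZ YZ → linear ml (suc v) eq
        (λ { zero _ r → refl ; (suc u) u≢v → XZ u (u≢v ∘ cong suc) })
        (λ { zero _ r → refl ; (suc u) u≢v → YZ u (u≢v ∘ cong suc) })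
    }

  ∏ : ∀ {m} → (Fin m → Carrier) → Carrier
  ∏ f = prodL K (tabulate f)

  -- The first column is expanded and then frozen in front, which leaves a multilinear function of
  -- one column fewer.
  multilinear-expand : ∀ {a} {X : Set a} {m} {Ψ : (Fin m → Column) → Carrier} → Multilinear Ψ → ∀ {Z}
    (os : Fin m → List X) (w : Fin m → X → Carrier) (col : Fin m → X → Column) →
    (∀ v r → Z v r ≈ ∑ (os v) (λ x → w v x * col v x r)) →
    Ψ Z ≈ ∑ (vecs m os) (λ f → ∏ (λ v → w v (lookup f v)) * Ψ (λ v → col v (lookup f v)))
  multilinear-expand {m = zero}  ml os w col eq =
    sym (trans (+-identityʳ _) (trans (*-identityˡ _) (congruent ml λ ())))
  multilinear-expand {m = suc m} {Ψ} ml {Z} os w col eq = begin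
    Ψ Z
      ≈⟨ multilinear-∑ ml zero (w zero) (λ x → col zero x ◃ (Z ∘ suc)) (os zero)
           (λ { x zero u≢0 → contradiction ≡.refl u≢0 ; x (suc u) _ r → refl }) (eq zero) ⟩
    ∑ (os zero) (λ x → w zero x * Ψ (col zero x ◃ (Z ∘ suc)))
      ≈⟨ ∑-cong (os zero) (λ x → trans
           (*-congˡ (multilinear-expand (multilinear-◃ ml (col zero x)) (os ∘ suc) (w ∘ suc) (col ∘ suc) (eq ∘ suc)))
           (trans (∑-distribˡ _ _ (vecs m (os ∘ suc)))
             (∑-cong (vecs m (os ∘ suc)) (λ f → trans (sym (*-assoc _ _ _))
               (*-congˡ (congruent ml λ { zero r → refl ; (suc v) r → refl })))))) ⟩
    ∑ (os zero) (λ x → ∑ (vecs m (os ∘ suc)) (λ f → term (x ∷ f)))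
      ≈⟨ ∑-product term _∷_ (os zero) (vecs m (os ∘ suc)) ⟨
    ∑ (vecs (suc m) os) term ∎
    where
    term = λ f → ∏ (λ v → w v (lookup f v)) * Ψ (λ v → col v (lookup f v))

-- Walks and parent maps

does⇒ : ∀ {a} {A : Set a} (d : Dec A) → does d ≡ true → A
does⇒ (yes a) _ = a

vec-ext : ∀ {a} {A : Set a} {m} {xs ys : Vec A m} → (∀ v → lookup xs v ≡ lookup ys v) → xs ≡ ys
vec-ext eq = ≡.trans (≡.sym (tabulate∘lookup _)) (≡.trans (tabulate-cong eq) (tabulate∘lookup _))

bool-ext : ∀ {b b'} → (b ≡ true → b' ≡ true) → (b' ≡ true → b ≡ true) → b ≡ b'
bool-ext {false} {false} f g = ≡.refl
bool-ext {false} {true}  f g = g ≡.refl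
bool-ext {true}  {b'}    f g = ≡.sym (f ≡.refl)

unique-∷ : ∀ {a} {A : Set a} {x : A} {xs} → x ∉ xs → Unique xs → Unique (x ∷ xs)
unique-∷ x∉ u = Allₚ.¬Any⇒All¬ _ x∉ ∷ u

unique-∉ : ∀ {a} {A : Set a} {x : A} {xs} → Unique (x ∷ xs) → x ∉ xs
unique-∉ (x∉ ∷ _) = Allₚ.All¬⇒¬Any x∉

module Walks {n} (F : Rel n) where
  open ≡ using (refl; sym; trans; subst)
  open import Data.List.Membership.DecPropositional (Finₚ._≟_ {n}) using (_∈?_)

  adj-sym : ∀ {a b} → Adj F a b → Adj F b a
  adj-sym (inj₁ e) = inj₂ e
  adj-sym (inj₂ e) = inj₁ e

  start∈ : ∀ {a b vs} → Walk F a b vs → a ∈ vs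
  start∈ here       = here refl
  start∈ (step _ _) = here refl

  end∈ : ∀ {a b vs} → Walk F a b vs → b ∈ vs
  end∈ here       = here refl
  end∈ (step _ w) = there (end∈ w)

  -- Vertex lists are tracked only up to inclusion: later arguments ask which vertices a walk
  -- avoids, not in which order it meets them.
  walk-++ : ∀ {a b c vs ws} → Walk F a b vs → Walk F b c ws →
            ∃ λ us → Walk F a c us × (∀ {x} → x ∈ us → x ∈ vs ⊎ x ∈ ws)
  walk-++ {ws = ws} here w' = ws , w' , inj₂
  walk-++ (step {a} e w) w' with us , w'' , sub ← walk-++ w w' =
    a ∷ us , step e w'' ,
    λ { (here eq) → inj₁ (here eq)
      ; (there x∈) → case sub x∈ of λ { (inj₁ x∈vs) → inj₁ (there x∈vs) ; (inj₂ x∈ws) → inj₂ x∈ws } }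

  walk-reverse : ∀ {a b vs} → Walk F a b vs → ∃ λ us → Walk F b a us × (∀ {x} → x ∈ us → x ∈ vs)
  walk-reverse here = _ , here , λ x∈ → x∈
  walk-reverse (step e w) with us , w' , sub ← walk-reverse w
    with us' , w'' , sub' ← walk-++ w' (step (adj-sym e) here) =
    us' , w'' , λ x∈ → case sub' x∈ of λ
      { (inj₁ x∈us) → there (sub x∈us)
      ; (inj₂ (here refl)) → there (start∈ w)
      ; (inj₂ (there (here refl))) → here refl }

  connected-refl : ∀ {a} → Connected F a a
  connected-refl = _ , here

  connected-trans : ∀ {a b c} → Connected F a b → Connected F b c → Connected F a c
  connected-trans (_ , w) (_ , w') with us , w'' , _ ← walk-++ w w' = us , w''

  connected-sym : ∀ {a b} → Connected F a b → Connected F b a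
  connected-sym (_ , w) with us , w' , _ ← walk-reverse w = us , w'

  connected-adj : ∀ {a b} → Adj F a b → Connected F a b
  connected-adj e = _ , step e here

  Simple : Fin n → Fin n → (Fin n → Set) → Set
  Simple a b P = ∃ λ us → Walk F a b us × Unique us × (∀ {x} → x ∈ us → P x)

  suffix : ∀ {a b c vs} → Walk F b c vs → Unique vs → a ∈ vs → Simple a c (_∈ vs)
  suffix w u (here refl) with w
  ... | here = _ , here , u , λ x∈ → x∈
  ... | step e w' = _ , step e w' , u , λ x∈ → x∈
  suffix (step e w) (_ ∷ u) (there a∈) with us , w' , u' , sub ← suffix w u a∈ = us , w' , u' , there ∘ sub

  -- Loop erasure: if the start reappears in the simplified rest, everything before that
  -- reappearance is discarded.
  simplify : ∀ {a b vs} → Walk F a b vs → Simple a b (_∈ vs)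
  simplify here = _ , here , ([] ∷ []) , λ x∈ → x∈
  simplify (step {a} e w) with us , w' , u , sub ← simplify w with a ∈? us
  ... | yes a∈ with us' , w'' , u' , sub' ← suffix w' u a∈ = us' , w'' , u' , there ∘ sub ∘ sub'
  ... | no  a∉ = a ∷ us , step e w' , unique-∷ a∉ u , λ { (here eq) → here eq ; (there x∈) → there (sub x∈) }

  prefix-avoiding : ∀ {r v u vs} → Walk F r v vs → Unique vs → u ∈ vs → u ≢ v → ∃ λ us → Walk F r u us × v ∉ us
  prefix-avoiding here         _       (here refl) u≢v = contradiction refl u≢v
  prefix-avoiding (step {a} e w) uniq  (here refl) u≢v = a ∷ [] , here , λ { (here refl) → u≢v refl }
  prefix-avoiding (step {a} e w) (a∉ ∷ uniq) (there u∈) u≢v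
    with us , w' , v∉ ← prefix-avoiding w uniq u∈ u≢v =
    a ∷ us , step e w' , λ { (here refl) → Allₚ.All¬⇒¬Any a∉ (end∈ w) ; (there v∈) → v∉ v∈ }

  simple-loop : ∀ {a vs} → Walk F a a vs → Unique vs → vs ≡ a ∷ []
  simple-loop here       u = refl
  simple-loop (step e w) u = contradiction (end∈ w) (unique-∉ u)

  -- Otherwise a simple walk from `u` to `u'` avoiding `v`, closed up by the two edges at `v`, is a
  -- cycle; `long` secures its three vertices.
  no-detour : ¬ HasCycle F → ∀ {u u' v ws} → Adj F u v → Adj F u' v → Walk F u u' ws → v ∉ ws → u ≡ u'
  no-detour acyclic {u} {u'} {v} e e' w v∉ with us , w' , uniq , sub ← simplify w with u Finₚ.≟ u'
  ... | yes u≡u' = u≡u'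
  ... | no  u≢u' = contradiction
    (v , u' , v ∷ us , step (adj-sym e) w' , unique-∷ (v∉ ∘ sub) uniq , ℕ.s≤s (long w' u≢u') , e') acyclic
    where
    long : ∀ {a b vs} → Walk F a b vs → a ≢ b → 2 ℕ.≤ length vs
    long here a≢b = contradiction refl a≢b
    long (step _ here) _ = ℕ.s≤s (ℕ.s≤s ℕ.z≤n)
    long (step _ (step _ _)) _ = ℕ.s≤s (ℕ.s≤s ℕ.z≤n)

  module _ (forest : IsDirectedForest F) {r} (away : OrientedAwayFrom F r) where

    -- The orientation puts `u` on a simple path from `r` to `r`, which consists of `r` alone, so
    -- the edge would be a loop.
    root-no-parent : ∀ {u} → ¬ Edge F u r
    root-no-parent {u} e with vs , w , uniq , u∈ ← away u r e connected-refl
      with refl ← simple-loop w uniq with here refl ← u∈ = proj₁ forest r e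

    -- Both `u` and `u'` lie on simple paths from `r` to `v`. Cut off before `v` and joined at `r`,
    -- these give a walk from `u` to `u'` that avoids `v`, so two different parents would close a
    -- cycle.
    parent-unique : ∀ {u u' v} → Connected F r v → Edge F u v → Edge F u' v → u ≡ u'
    parent-unique {u} {u'} {v} r~v e e'
      with vs , w , uniq , u∈ ← away u v e r~v
         | vs' , w' , uniq' , u'∈ ← away u' v e' r~v
      with us , p , v∉ ← prefix-avoiding w uniq u∈ (λ { refl → proj₁ forest v e })
         | us' , p' , v∉' ← prefix-avoiding w' uniq' u'∈ (λ { refl → proj₁ forest v e' })
      with us″ , q , sub ← walk-reverse p
      with ws , join , sub' ← walk-++ q p' =
      no-detour (proj₂ (proj₂ forest)) (inj₁ e) (inj₁ e') join
        (λ v∈ → case sub' v∈ of λ { (inj₁ x) → v∉ (sub x) ; (inj₂ x) → v∉' x })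

Parents : ℕ → Set
Parents n = Vec (Maybe (Fin n)) n

module Functional {n} (f : Parents n) where
  open ≡ using (refl; sym; trans; subst)

  parent : Fin n → Maybe (Fin n)
  parent = lookup f

  Root : Fin n → Set
  Root v = parent v ≡ nothing

  root? : ∀ v → Dec (Root v)
  root? v = ≡-dec Finₚ._≟_ (parent v) nothing

  -- Sending a root to itself makes `up` total, and iteration comes to rest at a root.
  up : Fin n → Fin n
  up v = fromMaybe v (parent v)

  up-just : ∀ {u v} → parent v ≡ just u → up v ≡ u
  up-just {v = v} eq = cong (fromMaybe v) eq

  parent-up : ∀ {v} → ¬ Root v → parent v ≡ just (up v)
  parent-up {v} ¬root with parent v
  ... | just u  = refl
  ... | nothing = contradiction refl ¬root

  up^ : ℕ → Fin n → Fin n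
  up^ zero    v = v
  up^ (suc k) v = up^ k (up v)

  up^-+ : ∀ k l v → up^ (k ℕ.+ l) v ≡ up^ l (up^ k v)
  up^-+ zero    l v = refl
  up^-+ (suc k) l v = up^-+ k l (up v)

  up^-suc : ∀ k v → up^ (suc k) v ≡ up (up^ k v)
  up^-suc zero    v = refl
  up^-suc (suc k) v = up^-suc k (up v)

  up^-root : ∀ k {v} → Root v → up^ k v ≡ v
  up^-root zero    root = refl
  up^-root (suc k) {v} root = trans (cong (up^ k) (cong (fromMaybe v) root)) (up^-root k root)

  -- Roots are periodic too, with period 1; a cycle of the parent map is witnessed by a periodic
  -- vertex that is not a root.
  Periodic : Fin n → Set
  Periodic w = ∃ λ m → up^ (suc m) w ≡ w

  periodic-multiple : ∀ {w} m k → up^ m w ≡ w → up^ (k ℕ.* m) w ≡ w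
  periodic-multiple m zero    eq = refl
  periodic-multiple m (suc k) eq = trans (up^-+ m (k ℕ.* m) _) (trans (cong (up^ (k ℕ.* m)) eq) (periodic-multiple m k eq))

  -- Running through `k` full periods leads back to `w`, but it also passes through the root
  -- `up^ k w`, where iteration stays.
  periodic-root : ∀ {w} → Periodic w → ∀ k → Root (up^ k w) → Root w
  periodic-root {w} (m , eq) k root = subst Root (trans (sym back) (periodic-multiple (suc m) k eq)) root
    where
    back : up^ (k ℕ.* suc m) w ≡ up^ k w
    back = trans (cong (λ l → up^ l w) (ℕₚ.*-suc k m)) (trans (up^-+ k (k ℕ.* m) w) (up^-root (k ℕ.* m) root))

  -- A path of distinct vertices has at most `n` of them, so `n` steps reach the root if there is
  -- one, and surplus steps stay there.
  top : Fin n → Fin n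
  top = up^ n

  -- Two of the `n + 1` iterates from 0 to `n` agree by the pigeonhole principle, so the earlier of
  -- them is periodic; were it a root, `top v` would be that root.
  reaches-root-or-cycle : ∀ v → Root (top v) ⊎ (∃₂ λ w a → w ≡ up^ a v × ¬ Root w × Periodic w)
  reaches-root-or-cycle v with root? (top v)
  ... | yes root = inj₁ root
  ... | no ¬root with a , b , a<b , eq ← Finₚ.pigeonhole (ℕₚ.n<1+n n) (λ k → up^ (toℕ k) v)
    with o , a+o≡b ← ℕₚ.m≤n⇒∃[o]m+o≡n a<b
       | o' , a+o'≡n ← ℕₚ.m≤n⇒∃[o]m+o≡n (Finₚ.toℕ≤pred[n] a) =
    inj₂ (up^ (toℕ a) v , toℕ a , refl ,
      (λ root → ¬root (subst Root (trans (sym (up^-root o' root))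
        (trans (sym (up^-+ (toℕ a) o' v)) (cong (λ k → up^ k v) a+o'≡n))) root)) ,
      o , trans (sym (up^-+ (toℕ a) (suc o) v))
            (trans (cong (λ k → up^ k v) (trans (ℕₚ.+-suc (toℕ a) o) a+o≡b)) (sym eq)))

  reaches-root : ∀ k {v} → Root (up^ k v) → Root (top v)
  reaches-root k {v} root with reaches-root-or-cycle v
  ... | inj₁ root' = root'
  ... | inj₂ (w , a , refl , ¬root , periodic) = contradiction
    (periodic-root periodic k (subst Root (trans (sym (up^-root a root)) (trans (sym (up^-+ k a v))
      (trans (cong (λ l → up^ l v) (ℕₚ.+-comm k a)) (up^-+ a k v)))) root)) ¬root

  top-unique : ∀ k {v} → Root (up^ k v) → top v ≡ up^ k v
  top-unique k {v} root = trans (sym (up^-root k (reaches-root k root)))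
    (trans (sym (up^-+ n k v)) (trans (cong (λ l → up^ l v) (ℕₚ.+-comm n k))
      (trans (up^-+ k n v) (up^-root n root))))

  Acyclic : Set
  Acyclic = ∀ v → Root (top v)

  top-root : ∀ {v} → Root v → top v ≡ v
  top-root = up^-root n

  top-up : Acyclic → ∀ v → top (up v) ≡ top v
  top-up acyclic v = trans (up^-suc n v) (up^-root 1 (acyclic v))

  acyclic-aperiodic : Acyclic → ∀ {w} → Periodic w → Root w
  acyclic-aperiodic acyclic {w} periodic = periodic-root periodic n (acyclic w)

  edge? : ∀ u v → Dec (parent v ≡ just u)
  edge? u v = ≡-dec Finₚ._≟_ (parent v) (just u)

  edges : Rel n
  edges = Vec.tabulate λ u → Vec.tabulate λ v → does (edge? u v)

  lookup-edges : ∀ u v → lookup (lookup edges u) v ≡ does (edge? u v)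
  lookup-edges u v = trans (cong (λ row → lookup row v) (lookup∘tabulate _ u)) (lookup∘tabulate _ v)

  edge⇒parent : ∀ {u v} → Edge edges u v → parent v ≡ just u
  edge⇒parent {u} {v} e = does⇒ (edge? u v) (trans (sym (lookup-edges u v)) e)

  parent⇒edge : ∀ {u v} → parent v ≡ just u → Edge edges u v
  parent⇒edge {u} {v} eq = trans (lookup-edges u v) (dec-true (edge? u v) eq)

  open Walks edges

  same-parent : ∀ {u u' v} → parent v ≡ just u → parent v ≡ just u' → u ≡ u'
  same-parent eq eq' = just-injective (trans (sym eq) eq')

  ParentOutside : Fin n → List (Fin n) → Set
  ParentOutside v vs = ∀ x → parent v ≡ just x → x ∉ vs

  -- Such a walk starts by moving to a child, and then each vertex entered has its only parent
  -- behind it, so that the walk keeps moving to children.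
  descend : ∀ {a b vs} → Walk edges a b vs → Unique vs → ParentOutside a vs →
            (∃ λ k → up^ k b ≡ a) × (a ≡ b ⊎ ∃ λ y → y ∈ vs × parent b ≡ just y)
  descend here _ _ = (0 , refl) , inj₁ refl
  descend (step {a} {c} {b} (inj₂ e) w) u out = contradiction (there (start∈ w)) (out c (edge⇒parent e))
  descend (step {a} {c} {b} (inj₁ e) w) u@(_ ∷ u') out
    with (k , eq) , last ← descend w u'
           (λ x x-parent x∈ → unique-∉ u (subst (_∈ _) (same-parent x-parent (edge⇒parent e)) x∈)) =
    (suc k , trans (up^-suc k b) (trans (cong up eq) (up-just (edge⇒parent e)))) ,
    (case last of λ { (inj₁ refl) → inj₂ (a , here refl , edge⇒parent e)
                    ; (inj₂ (y , y∈ , eq)) → inj₂ (y , there y∈ , eq) })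

  -- Counterpart of `descend`, with the condition at the end of the walk. A first step to a child
  -- `c` is impossible: the parent of `c` is then `a`, whereas by induction it lies further along
  -- the walk, or `c` is `b`, whose parent is off the walk.
  ascend : ∀ {a b vs} → Walk edges a b vs → Unique vs → ParentOutside b vs →
           (∃ λ k → up^ k a ≡ b) × (a ≡ b ⊎ ∃ λ y → y ∈ vs × parent a ≡ just y)
  ascend here _ _ = (0 , refl) , inj₁ refl
  ascend (step {a} {c} {b} e w) u@(_ ∷ u') out with ascend w u' (λ x eq x∈ → out x eq (there x∈)) | e
  ... | (k , eq) , _ | inj₂ e = (suc k , trans (cong (up^ k) (up-just (edge⇒parent e))) eq) ,
                                inj₂ (c , there (start∈ w) , edge⇒parent e)
  ... | _ , inj₁ refl | inj₁ e = contradiction (here refl) (out a (edge⇒parent e))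
  ... | _ , inj₂ (y , y∈ , eq) | inj₁ e = contradiction (subst (_∈ _) (same-parent eq (edge⇒parent e)) y∈) (unique-∉ u)

  parent≢nothing : ∀ {u v} → parent v ≡ just u → ¬ Root v
  parent≢nothing eq root with () ← trans (sym eq) root

  connected-up^ : ∀ k v → Connected edges v (up^ k v)
  connected-up^ zero    v = connected-refl
  connected-up^ (suc k) v with root? v
  ... | yes root = subst (Connected edges v) (sym (up^-root (suc k) root)) connected-refl
  ... | no ¬root = connected-trans (connected-adj (inj₂ (parent⇒edge (parent-up ¬root)))) (connected-up^ k (up v))

  -- A root has no parent, so the condition of `descend` is vacuous. The lemma precedes acyclicity
  -- because it serves to establish it for the parent map of an admissible pair.
  root-descend : ∀ {r v} → Root r → Connected edges r v → top v ≡ r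
  root-descend {r} {v} root (_ , w) with us , w' , u , _ ← simplify w
    with (k , eq) , _ ← descend w' u (λ x eq → contradiction root (parent≢nothing eq)) =
    trans (top-unique k (subst Root (sym eq) root)) eq

  module _ (acyclic : Acyclic) where

    -- A vertex has at most one parent, so the edges of a cycle must all point the same way round.
    -- `descend` or `ascend`, depending on the closing edge, follows the rest of the cycle, and `a`
    -- comes out periodic without being a root.
    no-cycle : ¬ HasCycle edges
    no-cycle (a , b , _ , here , _ , ℕ.s≤s () , _)
    no-cycle (a , b , _ , step e here , _ , ℕ.s≤s (ℕ.s≤s ()) , _)
    no-cycle (a , b , _ , step {b = c} e (step e' w) , u@(_ ∷ u'@(_ ∷ _)) , _ , inj₁ closing)
      with e
    ... | inj₂ a-to-c = contradiction (subst (_∈ _) (same-parent (edge⇒parent closing) (edge⇒parent a-to-c)) (end∈ w))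
                                      (unique-∉ u')
    ... | inj₁ a-of-c with (k , eq) , _ ← descend (step e' w) u'
              (λ x x-parent x∈ → unique-∉ u (subst (_∈ _) (same-parent x-parent (edge⇒parent a-of-c)) x∈)) =
      contradiction
        (acyclic-aperiodic acyclic {a} (suc k , trans (cong (up^ (suc k)) (up-just (edge⇒parent closing)))
          (trans (up^-suc k b) (trans (cong up eq) (up-just (edge⇒parent a-of-c))))))
        (parent≢nothing (edge⇒parent closing))
    no-cycle (a , b , _ , step {b = c} e (step e' w) , u@(_ ∷ u'@(_ ∷ _)) , _ , inj₂ closing)
      with ascend (step e' w) u' (λ x x-parent x∈ → unique-∉ u (subst (_∈ _) (same-parent x-parent (edge⇒parent closing)) x∈)) | e
    ... | (k , eq) , _ | inj₂ a-to-c = contradiction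
        (acyclic-aperiodic acyclic {a} (suc k , trans (cong (up^ (suc k)) (up-just (edge⇒parent a-to-c)))
          (trans (up^-suc k c) (trans (cong up eq) (up-just (edge⇒parent closing))))))
        (parent≢nothing (edge⇒parent a-to-c))
    ... | _ , inj₁ refl | inj₁ a-of-c = contradiction (end∈ w) (unique-∉ u')
    ... | _ , inj₂ (y , y∈ , eq) | inj₁ a-of-c =
      contradiction (subst (_∈ _) (same-parent eq (edge⇒parent a-of-c)) y∈) (unique-∉ u)

    isDirectedForest : IsDirectedForest edges
    isDirectedForest =
      -- A loop and a pair of opposite edges are cycles of the parent map of lengths 1 and 2.
      (λ u e → loop 0 (edge⇒parent e) (up-just (edge⇒parent e))) ,
      (λ u v e e' → loop 1 (edge⇒parent e)
        (trans (cong up (up-just (edge⇒parent e))) (up-just (edge⇒parent e')))) ,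
      no-cycle
      where
      loop : ∀ m {u v} → parent v ≡ just u → up^ (suc m) v ≡ v → ⊥
      loop m eq cyc = parent≢nothing eq (acyclic-aperiodic acyclic (m , cyc))

    -- Every edge joins a vertex to its parent, and both have the same root. Together with
    -- `top⇒connected` this makes `top` a label for the connected components.
    connected⇒top : ∀ {a b} → Connected edges a b → top a ≡ top b
    connected⇒top (_ , w) = go w
      where
      go : ∀ {a b vs} → Walk edges a b vs → top a ≡ top b
      go here = refl
      go (step {a} {c} (inj₁ e) w) =
        trans (trans (cong top (sym (up-just (edge⇒parent e)))) (top-up acyclic c)) (go w)
      go (step {a} {c} (inj₂ e) w) =
        trans (trans (sym (top-up acyclic a)) (cong top (up-just (edge⇒parent e)))) (go w)

    connected-top : ∀ v → Connected edges v (top v)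
    connected-top = connected-up^ n

    top⇒connected : ∀ {a b} → top a ≡ top b → Connected edges a b
    top⇒connected {a} {b} eq = connected-trans (connected-top a)
      (subst (λ t → Connected edges t b) (sym eq) (connected-sym (connected-top b)))

    -- A simple walk from a root only descends, so it enters `v` from its parent `u`; this is the
    -- second conclusion of `descend`.
    root-oriented : ∀ {r} → Root r → OrientedAwayFrom edges r
    root-oriented {r} root u v e (_ , w) with us , w' , uniq , _ ← simplify w
      with descend w' uniq (λ x eq → contradiction root (parent≢nothing eq))
    ... | _ , inj₁ refl = contradiction root (parent≢nothing (edge⇒parent e))
    ... | _ , inj₂ (y , y∈ , eq) = us , w' , uniq , subst (_∈ us) (same-parent eq (edge⇒parent e)) y∈

edges-injective : ∀ {n} {f g : Parents n} → Functional.edges f ≡ Functional.edges g → f ≡ g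
edges-injective {n} {f} {g} eq = vec-ext same
  where
  open ≡ using (refl; sym; trans; subst)
  open Functional
  transfer : ∀ (f g : Parents n) → edges f ≡ edges g → ∀ u v → parent f v ≡ just u → parent g v ≡ just u
  transfer f g eq u v e = edge⇒parent g (subst (λ F → Edge F u v) eq (parent⇒edge f e))
  same : ∀ v → lookup f v ≡ lookup g v
  same v with lookup f v in eq-f | lookup g v in eq-g
  ... | just u  | _       = trans (sym (transfer f g eq u v eq-f)) eq-g
  ... | nothing | nothing = refl
  ... | nothing | just u  = trans (sym eq-f) (transfer g f (sym eq) u v eq-g)

-- Correspondence between parent maps and admissible pairs

module Admissible {n p} (i j : Fin p → Fin n)
  (i-injective : ∀ {α β} → i α ≡ i β → α ≡ β) (j-injective : ∀ {α β} → j α ≡ j β → α ≡ β) where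
  open ≡ using (refl; sym; trans; subst)

  inJ? : ∀ v → Dec (∃ λ α → j α ≡ v)
  inJ? v = any? (λ α → j α Finₚ.≟ v)

  module _ (f : Parents n) where
    open Functional f

    FreeRoot? : ∀ v → Dec (Root v × ¬ (∃ λ α → j α ≡ v))
    FreeRoot? v = root? v ×-dec ¬? (inJ? v)

    freeRoots : Sub n
    freeRoots = Vec.tabulate λ v → does (FreeRoot? v)

    freeRoot⇒ : ∀ {v} → lookup freeRoots v ≡ true → Root v × ¬ (∃ λ α → j α ≡ v)
    freeRoot⇒ {v} eq = does⇒ (FreeRoot? v) (trans (sym (lookup∘tabulate _ v)) eq)

    ⇒freeRoot : ∀ {v} → Root v → ¬ (∃ λ α → j α ≡ v) → lookup freeRoots v ≡ true
    ⇒freeRoot {v} root v∉J = trans (lookup∘tabulate _ v) (dec-true (FreeRoot? v) (root , v∉J))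

    -- Admissibility as seen from the parent map: `admissible` and `isSigma` lead from here to an
    -- admissible pair with its permutation, and `FromPair` leads back.
    record Matching (σ : Vec (Fin p) p) : Set where
      field
        J-root  : ∀ α → Root (j α)
        acyclic : Acyclic
        matches : ∀ α → top (i (lookup σ α)) ≡ j α

      σ-injective : ∀ {α β} → lookup σ α ≡ lookup σ β → α ≡ β
      σ-injective eq = j-injective (trans (sym (matches _)) (trans (cong (top ∘ i) eq) (matches _)))

      σ-unique : ∀ {α β} → top (i β) ≡ j α → β ≡ lookup σ α
      σ-unique {α} {β} eq with γ , refl ← injective⇒surjective (lookup σ) σ-injective β =
        cong (lookup σ) (j-injective (trans (sym (matches γ)) eq))

      top-i∈J : ∀ β → ∃ λ α → j α ≡ top (i β)
      top-i∈J β with γ , refl ← injective⇒surjective (lookup σ) σ-injective β = γ , sym (matches γ)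

      open Walks edges

      connected⇒top≡ : ∀ {x r} → Root r → Connected edges x r → top x ≡ r
      connected⇒top≡ root x~r = trans (connected⇒top acyclic x~r) (top-root root)

      free⇒top∉J : ∀ {x} → Free i j edges x → ¬ (∃ λ α → j α ≡ top x)
      free⇒top∉J {x} free (α , eq) = proj₂ (free α)
        (subst (Connected edges x) (sym eq) (connected-top acyclic x))

      top∉J⇒free : ∀ {x} → ¬ (∃ λ α → j α ≡ top x) → Free i j edges x
      top∉J⇒free top∉J α =
        (λ x~i → top∉J (proj₁ (top-i∈J α) , trans (proj₂ (top-i∈J α)) (sym (connected⇒top acyclic x~i)))) ,
        (λ x~j → top∉J (α , sym (connected⇒top≡ (J-root α) x~j)))

      admissible : AdmissiblePair i j edges freeRoots
      admissible =
        (isDirectedForest acyclic , blocks , (λ α β _ → root-oriented acyclic (J-root β))) ,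
        (λ x free → top x , ⇒freeRoot (acyclic x) (free⇒top∉J free) , connected-top acyclic x ,
           λ r' r'-free x~r' → sym (connected⇒top≡ (proj₁ (freeRoot⇒ r'-free)) x~r')) ,
        (λ r r-free → top∉J⇒free (λ (α , eq) →
           proj₂ (freeRoot⇒ r-free) (α , trans eq (top-root (proj₁ (freeRoot⇒ r-free)))))) ,
        (λ r r-free → root-oriented acyclic (proj₁ (freeRoot⇒ r-free)))
        where
        blocks : ∀ x → Free i j edges x ⊎ (ExactlyOne i j edges i x × ExactlyOne i j edges j x)
        blocks x with inJ? (top x)
        ... | no  top∉J = inj₁ (top∉J⇒free top∉J)
        ... | yes (α , eq) = inj₂
          ( (lookup σ α , top⇒connected acyclic (trans (sym eq) (sym (matches α))) ,
              λ β x~iβ → σ-unique (trans (sym (connected⇒top acyclic x~iβ)) (sym eq)))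
          , (α , subst (Connected edges x) (sym eq) (connected-top acyclic x) ,
              λ β x~jβ → j-injective (trans (sym (connected⇒top≡ (J-root β) x~jβ)) (sym eq))) )

      isSigma : IsSigma i j edges σ
      isSigma α = top⇒connected acyclic (trans (top-root (J-root α)) (sym (matches α)))

  σ-determined : ∀ {f : Parents n} {σ σ' : Vec (Fin p) p} → Matching f σ → Matching f σ' → σ ≡ σ'
  σ-determined {f} m m' = vec-ext λ α → Matching.σ-unique {f} m' (Matching.matches {f} m α)

  module FromPair {F R σ} (pair : AdmissiblePair i j F R) (isSigma : IsSigma i j F σ) where
    open Walks F

    private
      forest : IsDirectedForest F
      forest = proj₁ (proj₁ pair)

    -- The orientation condition speaks of an element of J together with an element of I in its
    -- block. The latter exists because the block of `j α` is not free.
    J-oriented : ∀ α → OrientedAwayFrom F (j α)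
    J-oriented α with proj₁ (proj₂ (proj₁ pair)) (j α)
    ... | inj₁ free = contradiction connected-refl (proj₂ (free α))
    ... | inj₂ ((β , jα~iβ , _) , _) = proj₂ (proj₂ (proj₁ pair)) β α (connected-sym jα~iβ)

    -- The vertices away from which the blocks are oriented; they become the roots of `parents`.
    IsRoot : Fin n → Set
    IsRoot r = (∃ λ α → j α ≡ r) ⊎ lookup R r ≡ true

    root-of : ∀ x → ∃ λ r → IsRoot r × Connected F r x
    root-of x with proj₁ (proj₂ (proj₁ pair)) x
    ... | inj₁ free with r , r∈R , x~r , _ ← proj₁ (proj₂ pair) x free = r , inj₂ r∈R , connected-sym x~r
    ... | inj₂ (_ , (α , x~jα , _)) = j α , inj₁ (α , refl) , connected-sym x~jα

    isRoot-oriented : ∀ {r} → IsRoot r → OrientedAwayFrom F r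
    isRoot-oriented (inj₁ (α , refl)) = J-oriented α
    isRoot-oriented (inj₂ r∈R)        = proj₂ (proj₂ (proj₂ pair)) _ r∈R

    parent? : ∀ v → Dec (∃ λ u → Edge F u v)
    parent? v = any? λ u → lookup (lookup F u) v Boolₚ.≟ true

    parentIn : ∀ {v} → Dec (∃ λ u → Edge F u v) → Maybe (Fin n)
    parentIn (yes (u , _)) = just u
    parentIn (no _)        = nothing

    parents : Parents n
    parents = Vec.tabulate λ v → parentIn (parent? v)

    open Functional parents

    parent-parents : ∀ v → parent v ≡ parentIn (parent? v)
    parent-parents v = lookup∘tabulate _ v

    parent⇒ : ∀ {u v} → parent v ≡ just u → Edge F u v
    parent⇒ {u} {v} eq with parent? v | trans (sym (parent-parents v)) eq
    ... | yes (_ , e) | refl = e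

    -- `parent?` returns some edge into `v`; its source is `u` because `parent-unique` applies in
    -- the oriented block of `v`.
    ⇒parent : ∀ {u v} → Edge F u v → parent v ≡ just u
    ⇒parent {u} {v} e with parent? v | parent-parents v
    ... | no none | _ = contradiction (u , e) none
    ... | yes (u' , e') | eq with r , isRoot , r~v ← root-of v =
      trans eq (cong just (parent-unique forest (isRoot-oriented isRoot) r~v e' e))

    edges≡F : edges ≡ F
    edges≡F = vec-ext λ u → vec-ext λ v → bool-ext
      (λ e → parent⇒ (edge⇒parent e)) (λ e → parent⇒edge (⇒parent e))

    isRoot⇒Root : ∀ {r} → IsRoot r → Root r
    isRoot⇒Root {r} isRoot with parent r in eq
    ... | nothing = refl
    ... | just u  = contradiction (parent⇒ eq) (root-no-parent forest (isRoot-oriented isRoot))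

    connected⇒edges : ∀ {a b} → Connected F a b → Connected edges a b
    connected⇒edges {a} {b} = subst (λ G → Connected G a b) (sym edges≡F)

    top-of : ∀ {r x} → IsRoot r → Connected F r x → top x ≡ r
    top-of isRoot r~x = root-descend (isRoot⇒Root isRoot) (connected⇒edges r~x)

    matching : Matching parents σ
    matching = record
      { J-root  = λ α → isRoot⇒Root (inj₁ (α , refl))
      ; acyclic = λ x → let r , isRoot , r~x = root-of x in
                        subst Root (sym (top-of isRoot r~x)) (isRoot⇒Root isRoot)
      ; matches = λ α → top-of (inj₁ (α , refl)) (isSigma α)
      }

    freeRoots≡R : freeRoots parents ≡ R
    freeRoots≡R = vec-ext λ v → bool-ext (to v) (from v)
      where
      from : ∀ v → lookup R v ≡ true → lookup (freeRoots parents) v ≡ true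
      from v v∈R = ⇒freeRoot parents (isRoot⇒Root (inj₂ v∈R))
        λ { (α , refl) → proj₂ (proj₁ (proj₂ (proj₂ pair)) v v∈R α) connected-refl }
      to : ∀ v → lookup (freeRoots parents) v ≡ true → lookup R v ≡ true
      to v v-free with root , v∉J ← freeRoot⇒ parents v-free with root-of v
      -- A root of `parents` is its own `top`, so the distinguished vertex of its block is the
      -- vertex itself.
      ... | r , isRoot , r~v with refl ← trans (sym (top-root root)) (top-of isRoot r~v) with isRoot
      ...   | inj₁ v∈J = contradiction v∈J v∉J
      ...   | inj₂ v∈R = v∈R

  module _ (f : Parents n) where
    open Functional f

    -- The ways of failing to be a matching, each with the witnesses that the vanishing of the
    -- determinant needs.
    data Degenerate : Set where
      cyclic   : ∀ {w} → ¬ Root w → Periodic w → Degenerate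
      unrooted : Acyclic → ∀ β → ¬ (∃ λ α → j α ≡ top (i β)) → Degenerate
      shared   : Acyclic → ∀ {β γ} → β ≢ γ → top (i β) ≡ top (i γ) → Degenerate

    matching⇒¬degenerate : ∀ {σ} → Matching f σ → ¬ Degenerate
    matching⇒¬degenerate m (cyclic ¬root periodic) = ¬root (acyclic-aperiodic (Matching.acyclic m) periodic)
    matching⇒¬degenerate m (unrooted _ β β∉J)      = β∉J (Matching.top-i∈J m β)
    matching⇒¬degenerate m (shared _ β≢γ eq) with α , eq-α ← Matching.top-i∈J m _ =
      β≢γ (trans (Matching.σ-unique m (sym eq-α)) (sym (Matching.σ-unique m (trans (sym eq) (sym eq-α)))))

    -- If every `i β` lies below some `j (τ β)` and no two of them share a root, `τ` is injective.
    -- As I and J have the same size it is then a bijection, and `σ` is its inverse.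
    classify : (∀ α → Root (j α)) → (∃ (Matching f)) ⊎ Degenerate
    classify J-root with Finₚ.all? (λ v → root? (top v))
    ... | no ¬acyclic with v , ¬root ← Finₚ.¬∀⟶∃¬ n _ (λ v → root? (top v)) ¬acyclic
        with reaches-root-or-cycle v
    ...   | inj₁ root = contradiction root ¬root
    ...   | inj₂ (_ , _ , _ , ¬root' , periodic) = inj₂ (cyclic ¬root' periodic)
    classify J-root | yes acyclic with Finₚ.all? (λ β → inJ? (top (i β)))
    ... | no ¬rooted with β , β∉J ← Finₚ.¬∀⟶∃¬ p _ (λ β → inJ? (top (i β))) ¬rooted = inj₂ (unrooted acyclic β β∉J)
    ... | yes rooted with any? (λ β → any? (λ γ → ¬? (β Finₚ.≟ γ) ×-dec (top (i β) Finₚ.≟ top (i γ))))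
    ...   | yes (β , γ , β≢γ , eq) = inj₂ (shared acyclic β≢γ eq)
    ...   | no distinct = inj₁ (Vec.tabulate (proj₁ ∘ inverse) , record
      { J-root = J-root ; acyclic = acyclic
      ; matches = λ α → trans (cong (top ∘ i) (lookup∘tabulate _ α))
                        (trans (sym (proj₂ (rooted _))) (cong j (proj₂ (inverse α)))) })
      where
      τ : Fin p → Fin p
      τ = proj₁ ∘ rooted
      τ-injective : ∀ {β γ} → τ β ≡ τ γ → β ≡ γ
      τ-injective {β} {γ} eq with β Finₚ.≟ γ
      ... | yes β≡γ = β≡γ
      ... | no  β≢γ = contradiction
        (β , γ , β≢γ , trans (sym (proj₂ (rooted β))) (trans (cong j eq) (proj₂ (rooted γ)))) distinct
      inverse : ∀ α → ∃ λ β → τ β ≡ α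
      inverse = injective⇒surjective τ τ-injective

-- Determinants of parent maps

module ForestDeterminant {c ℓ} (K : CommutativeRing c ℓ) {n p} (i j : Fin p → Fin n)
  (i-injective : ∀ {α β} → i α ≡ i β → α ≡ β) (j-injective : ∀ {α β} → j α ≡ j β → α ≡ β) where
  open CommutativeRing K hiding (zero)
  open RingProperties ring
  open SetoidReasoning setoid
  open Determinant K {n}
  open FamilyDeterminant K {n}
  open MinorAsDeterminant K {n} using (negPow-square)
  open Admissible i j i-injective j-injective
  open Signature K {Fin n} using (Antisymmetric; antisymmetric-permute)

  ⟨_⟩ : Maybe (Fin n) → Column
  ⟨ nothing ⟩ r = 0#
  ⟨ just u ⟩    = basis u

  arrow : Fin n → Maybe (Fin n) → Column
  arrow v x r = basis v r + - ⟨ x ⟩ r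

  -- Separates the slots in J, whose basis vectors are replaced and permuted, from the arrows
  -- outside J.
  family : (Fin p → Column) → (Fin n → Column) → (Fin n → Column)
  family a b v with inJ? v
  ... | yes (α , _) = a α
  ... | no  _       = b v

  family-at : ∀ a b α → family a b (j α) ≋ a α
  family-at a b α r with inJ? (j α)
  ... | no  none     = contradiction (α , ≡.refl) none
  ... | yes (β , eq) = reflexive (cong (λ γ → a γ r) (j-injective eq))

  family-off : ∀ a b {v} → ¬ (∃ λ α → j α ≡ v) → family a b v ≋ b v
  family-off a b {v} v∉J r with inJ? v
  ... | yes v∈J = contradiction v∈J v∉J
  ... | no  _   = refl

  family-≋ : ∀ a b {v x} → (∀ α → j α ≡ v → a α ≋ x) → (¬ (∃ λ α → j α ≡ v) → b v ≋ x) → family a b v ≋ x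
  family-≋ a b {v} on off with inJ? v
  ... | yes (α , eq) = on α eq
  ... | no  v∉J      = off v∉J

  sym-≋ : ∀ {x y} → x ≋ y → y ≋ x
  sym-≋ eq r = sym (eq r)

  trans-≋ : ∀ {x y z} → x ≋ y → y ≋ z → x ≋ z
  trans-≋ eq eq' r = trans (eq r) (eq' r)

  update-cong : ∀ {Z : Fin n → Column} {v x y} → x ≋ y → ∀ u → (Z [ v ≔ x ]) u ≋ (Z [ v ≔ y ]) u
  update-cong {v = v} eq u r with u Finₚ.≟ v
  ... | yes _ = eq r
  ... | no  _ = refl

  D-update : ∀ {Z : Fin n → Column} {v x} → Z v ≋ x → D (Z [ v ≔ x ]) ≈ D Z
  D-update {Z} {v} {x} eq = D-cong same
    where
    same : ∀ u → (Z [ v ≔ x ]) u ≋ Z u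
    same u r with u Finₚ.≟ v
    ... | yes ≡.refl = sym (eq r)
    ... | no  _      = refl

  D-updateAdd : ∀ {Z : Fin n → Column} {v x} a u → u ≢ v → (∀ r → x r ≈ Z v r + a * Z u r) →
                D (Z [ v ≔ x ]) ≈ D Z
  D-updateAdd {Z} {v} {x} a u u≢v eq = D-addColumn {Z} {Z [ v ≔ x ]} a u v u≢v
    (λ r → trans (update-at Z v x r) (eq r)) (λ w w≢v → sym-≋ (update-off Z v x w w≢v))

  D-updateUpdateAdd : ∀ {Z : Fin n → Column} {v x y} a u → u ≢ v → (∀ r → y r ≈ x r + a * Z u r) →
                      D (Z [ v ≔ y ]) ≈ D (Z [ v ≔ x ])
  D-updateUpdateAdd {Z} {v} {x} {y} a u u≢v eq = D-addColumn a u v u≢v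
    (λ r → trans (update-at Z v y r) (trans (eq r) (sym (+-cong (update-at Z v x r) (*-congˡ (update-off Z v x u u≢v r))))))
    (λ w w≢v → trans-≋ (update-off Z v x w w≢v) (sym-≋ (update-off Z v y w w≢v)))

  D-zeroColumn : ∀ {Z v} → Z v ≋ (λ _ → 0#) → D Z ≈ 0#
  D-zeroColumn {Z} {v} eq = begin
    D Z                   ≈⟨ D-linear v {Z} {Z} {Z} {0#} {0#}
                               (λ r → trans (eq r) (sym (trans (+-cong (zeroˡ _) (zeroˡ _)) (+-identityˡ 0#))))
                               (λ _ _ _ → refl) (λ _ _ _ → refl) ⟩
    0# * D Z + 0# * D Z   ≈⟨ trans (+-cong (zeroˡ _) (zeroˡ _)) (+-identityˡ 0#) ⟩
    0#                    ∎

  private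
    telescope : ∀ x y z → x + - z ≈ (x + - y) + 1# * (y + - z)
    telescope x y z = sym (begin
      (x + - y) + 1# * (y + - z)  ≈⟨ +-congˡ (*-identityˡ _) ⟩
      (x + - y) + (y + - z)       ≈⟨ +-assoc x (- y) _ ⟩
      x + (- y + (y + - z))       ≈⟨ +-congˡ (+-assoc (- y) y (- z)) ⟨
      x + ((- y + y) + - z)       ≈⟨ +-congˡ (+-congʳ (-‿inverseˡ y)) ⟩
      x + (0# + - z)              ≈⟨ +-congˡ (+-identityˡ _) ⟩
      x + - z                     ∎)

    x-0 : ∀ x → x + - 0# ≈ x
    x-0 x = trans (+-congˡ -0#≈0#) (+-identityʳ x)

    recover : ∀ x y → x ≈ (x + - y) + 1# * y
    recover x y = trans (sym (x-0 x)) (trans (telescope x y 0#) (+-congˡ (*-congˡ (x-0 y))))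

    negate : ∀ x → - x ≈ - 1# * x
    negate x = trans (-‿cong (sym (*-identityˡ x))) (-‿distribˡ-* 1# x)

    as-combination : ∀ x y → x + - y ≈ 1# * x + - 1# * y
    as-combination x y = +-cong (sym (*-identityˡ x)) (negate y)

    cancel-head : ∀ x y → - y ≈ (x + - y) + - 1# * x
    cancel-head x y = sym (begin
      (x + - y) + - 1# * x  ≈⟨ +-cong (+-comm x (- y)) (sym (negate x)) ⟩
      (- y + x) + - x       ≈⟨ +-assoc _ _ _ ⟩
      - y + (x + - x)       ≈⟨ +-congˡ (-‿inverseʳ x) ⟩
      - y + 0#              ≈⟨ +-identityʳ _ ⟩
      - y                   ∎)

    cancel-difference : ∀ x y → y ≈ x + - 1# * (x + - y)
    cancel-difference x y = sym (begin
      x + - 1# * (x + - y)  ≈⟨ +-congˡ (negate _) ⟨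
      x + - (x + - y)       ≈⟨ +-congˡ (-‿+-comm x (- y)) ⟨
      x + (- x + - - y)     ≈⟨ +-assoc _ _ _ ⟨
      (x + - x) + - - y     ≈⟨ +-cong (-‿inverseʳ x) (-‿involutive y) ⟩
      0# + y                ≈⟨ +-identityˡ y ⟩
      y                     ∎)

  module _ (f : Parents n) (J-root : ∀ α → Functional.Root f (j α)) where
    open Functional f

    nonroot∉J : ∀ {v} → ¬ Root v → ¬ (∃ λ α → j α ≡ v)
    nonroot∉J ¬root (α , ≡.refl) = ¬root (J-root α)

    root≢nonroot : ∀ {u v} → Root u → ¬ Root v → u ≢ v
    root≢nonroot root ¬root ≡.refl = ¬root root

    -- The parent map of the flattened forest, in which every other vertex hangs directly from its
    -- root.
    target : Fin n → Maybe (Fin n)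
    target v with root? v
    ... | yes _ = nothing
    ... | no  _ = just (top v)

    target-root : ∀ {v} → Root v → target v ≡ nothing
    target-root {v} root with root? v
    ... | yes _    = ≡.refl
    ... | no ¬root = contradiction root ¬root

    target-nonroot : ∀ {v} → ¬ Root v → target v ≡ just (top v)
    target-nonroot {v} ¬root with root? v
    ... | yes root = contradiction root ¬root
    ... | no _     = ≡.refl

    direct compressed : Fin n → Column
    direct v = arrow v (parent v)
    compressed v = arrow v (target v)

    compressed-root : ∀ {v} → Root v → compressed v ≋ basis v
    compressed-root {v} root r rewrite target-root root = x-0 _

    compressed-nonroot : ∀ {v} → ¬ Root v → compressed v ≋ arrow v (just (top v))
    compressed-nonroot {v} ¬root r = reflexive (cong (λ x → arrow v x r) (target-nonroot ¬root))

    direct-nonroot : ∀ {v} → ¬ Root v → direct v ≋ arrow v (just (up v))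
    direct-nonroot {v} ¬root r = reflexive (cong (λ x → arrow v x r) (parent-up ¬root))

    -- Adding the column of `u` to `e_v - e_u` telescopes and moves the subtracted vertex up from
    -- `u`. In the middle of the sweep the column of `u` may be old or new; accordingly `climb`
    -- moves one step or jumps to the root.
    D-compress : Acyclic → ∀ a → D (family a compressed) ≈ D (family a direct)
    D-compress acyclic a = D-sweep compress-at
      where
      compress-at : ∀ v Z →
        (∀ u → Z u ≋ family a direct u ⊎ Z u ≋ family a compressed u) → Z v ≋ family a direct v →
        D (Z [ v ≔ family a compressed v ]) ≈ D Z
      compress-at v Z mixed Zv with root? v
      ... | yes root = D-update (trans-≋ Zv (family-≋ a direct
              (λ { α ≡.refl → sym-≋ (family-at a compressed α) })
              (λ v∉J r → trans (reflexive (cong (λ x → arrow v x r) (≡.trans root (≡.sym (target-root root)))))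
                               (sym (family-off a compressed v∉J r)))))
      ... | no ¬root = begin
        D (Z [ v ≔ family a compressed v ])
          ≈⟨ D-cong (update-cong (trans-≋ (family-off a compressed (nonroot∉J ¬root)) (compressed-nonroot ¬root))) ⟩
        D (Z [ v ≔ arrow v (just (top v)) ])
          ≡⟨ cong (λ t → D (Z [ v ≔ arrow v (just t) ])) (top-up acyclic v) ⟨
        D (Z [ v ≔ arrow v (just (top (up v))) ])
          ≈⟨ climb n 0 (up v) ≡.refl (acyclic (up v)) ⟩
        D (Z [ v ≔ arrow v (just (up v)) ])
          ≈⟨ D-update (trans-≋ Zv (trans-≋ (family-off a direct (nonroot∉J ¬root)) (direct-nonroot ¬root))) ⟩
        D Z ∎
        where
        -- `m` bounds the steps left to the root and drives the recursion. `k` records that `u` lies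
        -- above `v`, so by acyclicity `u` is not `v` and its column is free to be added.
        climb : ∀ m k u → up^ (suc k) v ≡ u → Root (up^ m u) →
                D (Z [ v ≔ arrow v (just (top u)) ]) ≈ D (Z [ v ≔ arrow v (just u) ])
        climb m k u eq root-m with root? u
        ... | yes root = reflexive (cong (λ t → D (Z [ v ≔ arrow v (just t) ])) (top-root root))
        climb zero    k u eq root-m | no ¬root-u = contradiction root-m ¬root-u
        climb (suc m) k u eq root-m | no ¬root-u with mixed u
        ... | inj₂ Zu = D-updateUpdateAdd 1# u u≢v λ r → trans (telescope _ (basis u r) _)
                (+-congˡ (*-congˡ (sym (trans (Zu r)
                  (trans (family-off a compressed (nonroot∉J ¬root-u) r) (compressed-nonroot ¬root-u r))))))
          where
          u≢v : u ≢ v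
          u≢v ≡.refl = ¬root (acyclic-aperiodic acyclic (k , eq))
        ... | inj₁ Zu = begin
          D (Z [ v ≔ arrow v (just (top u)) ])
            ≡⟨ cong (λ t → D (Z [ v ≔ arrow v (just t) ])) (top-up acyclic u) ⟨
          D (Z [ v ≔ arrow v (just (top (up u))) ])
            ≈⟨ climb m (suc k) (up u) (≡.trans (up^-suc (suc k) v) (cong up eq)) root-m ⟩
          D (Z [ v ≔ arrow v (just (up u)) ])
            ≈⟨ D-updateUpdateAdd 1# u u≢v (λ r → trans (telescope _ (basis u r) _)
                (+-congˡ (*-congˡ (sym (trans (Zu r)
                  (trans (family-off a direct (nonroot∉J ¬root-u) r) (direct-nonroot ¬root-u r))))))) ⟩
          D (Z [ v ≔ arrow v (just u) ]) ∎
          where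
          u≢v : u ≢ v
          u≢v ≡.refl = ¬root (acyclic-aperiodic acyclic (k , eq))

    family-root : ∀ {v} → Root v → family (basis ∘ j) compressed v ≋ basis v
    family-root root = family-≋ (basis ∘ j) compressed (λ { α ≡.refl r → refl }) (λ _ → compressed-root root)

    -- With e_(j α) in the slots in J, all root columns are basis vectors, in both states of the
    -- sweep. Adding the column of `top v` to that of a nonroot `v` leaves e_v.
    D-family-basis : Acyclic → D (family (basis ∘ j) compressed) ≈ 1#
    D-family-basis acyclic = trans (sym (D-sweep add-root)) D-basis
      where
      add-root : ∀ v Z → (∀ u → Z u ≋ family (basis ∘ j) compressed u ⊎ Z u ≋ basis u) →
        Z v ≋ family (basis ∘ j) compressed v → D (Z [ v ≔ basis v ]) ≈ D Z
      add-root v Z mixed Zv with root? v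
      ... | yes root = D-update (trans-≋ Zv (family-root root))
      ... | no ¬root = D-updateAdd 1# (top v) (root≢nonroot (acyclic v) ¬root) λ r → trans (recover _ (basis (top v) r))
              (sym (+-cong (trans (Zv r) (trans (family-off (basis ∘ j) compressed (nonroot∉J ¬root) r)
                                                (compressed-nonroot ¬root r)))
                           (*-congˡ (Ztop r))))
        where
        Ztop : Z (top v) ≋ basis (top v)
        Ztop with mixed (top v)
        ... | inj₁ eq = trans-≋ eq (family-root (acyclic v))
        ... | inj₂ eq = eq

    -- Unless `i (lookup σ α)` is the root `j α` itself, its column is the difference of their basis
    -- vectors, and subtracting it from slot `j α` exchanges one basis vector for the other. As a
    -- nonroot it lies outside J, so the sweep never alters its column.
    D-match : ∀ {σ} → Matching f σ →
              D (family (basis ∘ j) compressed) ≈ D (family (basis ∘ i ∘ lookup σ) compressed)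
    D-match {σ} m = D-sweep match-at
      where
      open Matching {f} m using (matches)
      source = family (basis ∘ i ∘ lookup σ) compressed
      goal = family (basis ∘ j) compressed
      match-at : ∀ v Z → (∀ u → Z u ≋ source u ⊎ Z u ≋ goal u) → Z v ≋ source v → D (Z [ v ≔ goal v ]) ≈ D Z
      match-at v Z mixed Zv with inJ? v in eq-v
      ... | no  v∉J = D-update Zv
      ... | yes (α , ≡.refl) with root? (i (lookup σ α))
      ...   | yes root = D-update (trans-≋ Zv (λ r → reflexive (cong (λ u → basis u r)
                (≡.trans (≡.sym (top-root root)) (matches α)))))
      ...   | no ¬root = D-updateAdd (- 1#) (i (lookup σ α)) (λ eq → ¬root (≡.subst Root (≡.sym eq) (J-root α)))
                λ r → trans (cancel-difference _ _) (sym (+-cong (Zv r) (*-congˡ (Zi r))))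
        where
        Zi : Z (i (lookup σ α)) ≋ arrow (i (lookup σ α)) (just (j α))
        Zi = ≡.subst (λ t → Z (i (lookup σ α)) ≋ arrow (i (lookup σ α)) (just t)) (matches α) (trans-≋ off (compressed-nonroot ¬root))
          where
          off : Z (i (lookup σ α)) ≋ compressed (i (lookup σ α))
          off with mixed (i (lookup σ α))
          ... | inj₁ eq = trans-≋ eq (family-off (basis ∘ i ∘ lookup σ) compressed (nonroot∉J ¬root))
          ... | inj₂ eq = trans-≋ eq (family-off (basis ∘ j) compressed (nonroot∉J ¬root))

    antisymmetric-family : ∀ b → Antisymmetric {p} (λ w → D (family (basis ∘ w) b))
    antisymmetric-family b = record
      { congruent = λ {w} {w'} eq → D-cong λ v → family-≋ (basis ∘ w) b {v} {family (basis ∘ w') b v}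
          (λ { α ≡.refl r → trans (reflexive (cong (λ u → basis u r) (eq α))) (sym (family-at (basis ∘ w') b α r)) })
          (λ v∉J → sym-≋ (family-off (basis ∘ w') b v∉J))
      ; swap      = λ {w} {w'} α β α≢β eqα eqβ off → D-swap {u = j α} {j β} (α≢β ∘ j-injective)
          (move {w} {w'} eqα) (move {w} {w'} eqβ) (λ v v≢jα v≢jβ → family-≋ (basis ∘ w') b {v} {family (basis ∘ w) b v}
            (λ { γ ≡.refl r → trans (reflexive (cong (λ u → basis u r)
                     (off γ (v≢jα ∘ cong j) (v≢jβ ∘ cong j)))) (sym (family-at (basis ∘ w) b γ r)) })
            (λ v∉J → sym-≋ (family-off (basis ∘ w) b v∉J)))
      }
      where
      move : ∀ {w w' : Fin p → Fin n} {α β} → w' α ≡ w β →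
             family (basis ∘ w') b (j α) ≋ family (basis ∘ w) b (j β)
      move {w} {w'} {α} {β} eq r = trans (family-at (basis ∘ w') b α r)
        (trans (reflexive (cong (λ u → basis u r) eq)) (sym (family-at (basis ∘ w) b β r)))

    -- The column operations give `s * d ≈ 1#`, and `s` squares to 1.
    D-matching : ∀ {σ} → Matching f σ → D (family (basis ∘ i) direct) ≈ signature K σ
    D-matching {σ} m = begin
      d                    ≈⟨ *-identityˡ d ⟨
      1# * d               ≈⟨ *-congʳ (negPow-square (inversions σ)) ⟨
      (s * s) * d          ≈⟨ *-assoc s s d ⟩
      s * (s * d)          ≈⟨ *-congˡ one ⟨
      s * 1#               ≈⟨ *-identityʳ s ⟩
      s                    ∎
      where
      open Matching {f} m using (acyclic; σ-injective)
      d = D (family (basis ∘ i) direct)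
      s = signature K σ
      one : 1# ≈ s * d
      one = begin
        1#                                            ≈⟨ D-family-basis acyclic ⟨
        D (family (basis ∘ j) compressed)             ≈⟨ D-match m ⟩
        D (family (basis ∘ i ∘ lookup σ) compressed)
          ≈⟨ antisymmetric-permute (antisymmetric-family compressed) i σ σ-injective ⟩
        s * D (family (basis ∘ i) compressed)         ≈⟨ *-congˡ (D-compress acyclic (basis ∘ i)) ⟩
        s * d                                         ∎

    -- Adding the columns met on the way around the cycle to that of `w` telescopes to `e_w - e_w`.
    -- The uncompressed columns are used because compression presupposes acyclicity.
    D-cyclic : ∀ a {w} → ¬ Root w → Periodic w → D (family a direct) ≈ 0#
    D-cyclic a {w} ¬root (m , cycle) = trans
      (sym (D-update (trans-≋ (family-off a direct (nonroot∉J ¬root)) (direct-nonroot ¬root))))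
      (around m (up w) cycle)
      where
      X = family a direct
      close : D (X [ w ≔ arrow w (just w) ]) ≈ 0#
      close = D-zeroColumn {v = w} (λ r → trans (update-at X w _ r) (-‿inverseʳ _))
      -- `m` counts the steps until the ascent is back at `w`; if `w` is met sooner, the column is
      -- already zero.
      around : ∀ m u → up^ m u ≡ w → D (X [ w ≔ arrow w (just u) ]) ≈ 0#
      around zero    u ≡.refl = close
      around (suc m) u eq with u Finₚ.≟ w
      ... | yes ≡.refl = close
      ... | no  u≢w = trans
        (sym (D-updateUpdateAdd 1# u u≢w (λ r → trans (telescope _ (basis u r) _)
          (+-congˡ (*-congˡ (sym (trans (family-off a direct (nonroot∉J ¬root-u) r) (direct-nonroot ¬root-u r))))))))
        (around m (up u) eq)
        where
        ¬root-u : ¬ Root u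
        ¬root-u root = u≢w (≡.trans (≡.sym (up^-root (suc m) root)) eq)

    private
      Y : Fin n → Column
      Y = family (basis ∘ i) compressed

      Y-J : ∀ α → Y (j α) ≋ basis (i α)
      Y-J = family-at (basis ∘ i) compressed

      Y-nonroot : ∀ {v} → ¬ Root v → Y v ≋ arrow v (just (top v))
      Y-nonroot ¬root = trans-≋ (family-off (basis ∘ i) compressed (nonroot∉J ¬root)) (compressed-nonroot ¬root)

      Y-freeRoot : ∀ {v} → Root v → ¬ (∃ λ α → j α ≡ v) → Y v ≋ basis v
      Y-freeRoot root v∉J = trans-≋ (family-off (basis ∘ i) compressed v∉J) (compressed-root root)

    -- Let t be the root above `i β`. Its column is e_t because t is outside J, and slot `j β` holds
    -- e_(i β). If `i β` is t, these columns coincide; otherwise the column of `i β` is their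
    -- difference.
    D-unrooted : Acyclic → ∀ β → ¬ (∃ λ α → j α ≡ top (i β)) → D Y ≈ 0#
    D-unrooted acyclic β top∉J with root? (i β)
    ... | yes root = D-repeated {u = i β} {j β} (λ eq → iβ∉J (β , ≡.sym eq))
                       (trans-≋ (Y-freeRoot root iβ∉J) (sym-≋ (Y-J β)))
      where
      iβ∉J : ¬ (∃ λ α → j α ≡ i β)
      iβ∉J (α , eq) = top∉J (α , ≡.trans eq (≡.sym (top-root root)))
    ... | no ¬root = D-dependent 1# (- 1#) (j β) (top (i β)) (i β)
      (root≢nonroot (J-root β) ¬root) (root≢nonroot (acyclic (i β)) ¬root)
      λ r → trans (Y-nonroot ¬root r) (trans (as-combination _ _)
        (sym (+-cong (*-congˡ (Y-J β r)) (*-congˡ (Y-freeRoot (acyclic (i β)) top∉J r)))))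

    -- The shared root is `i β`, so the column of `i γ` is the difference of the columns in slots
    -- `j γ` and `j β`.
    D-rootShared : ∀ {β γ} → Root (i β) → ¬ Root (i γ) → top (i β) ≡ top (i γ) → D Y ≈ 0#
    D-rootShared {β} {γ} root-β ¬root-γ eq = D-dependent 1# (- 1#) (j γ) (j β) (i γ)
      (root≢nonroot (J-root γ) ¬root-γ) (root≢nonroot (J-root β) ¬root-γ)
      λ r → trans (Y-nonroot ¬root-γ r) (trans (as-combination _ _) (sym (+-cong (*-congˡ (Y-J γ r))
        (*-congˡ (trans (Y-J β r) (reflexive (cong (λ v → basis v r)
          (≡.trans (≡.sym (top-root root-β)) eq))))))))

    D-shared : Acyclic → ∀ {β γ} → β ≢ γ → top (i β) ≡ top (i γ) → D Y ≈ 0#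
    D-shared acyclic {β} {γ} β≢γ eq with root? (i β) | root? (i γ)
    ... | yes root-β | yes root-γ = contradiction
      (i-injective (≡.trans (≡.sym (top-root root-β)) (≡.trans eq (top-root root-γ)))) β≢γ
    ... | yes root-β | no ¬root-γ = D-rootShared root-β ¬root-γ eq
    ... | no ¬root-β | yes root-γ = D-rootShared root-γ ¬root-β (≡.sym eq)
    -- Subtracting the basis vectors held in slots `j β` and `j γ` leaves the negated basis vector
    -- of the common root at both `i β` and `i γ`.
    ... | no ¬root-β | no ¬root-γ = begin
      D Y   ≈⟨ D-updateAdd (- 1#) (j β) (root≢nonroot (J-root β) ¬root-β)
                 (λ r → trans (cancel-head _ _) (sym (+-cong (Y-nonroot ¬root-β r) (*-congˡ (Y-J β r))))) ⟨
      D Y₁  ≈⟨ D-updateAdd (- 1#) (j γ) (root≢nonroot (J-root γ) ¬root-γ)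
                 (λ r → trans (cancel-head _ _) (sym (+-cong
                    (trans (Y₁-off (iβ≢iγ ∘ ≡.sym) r) (Y-nonroot ¬root-γ r))
                    (*-congˡ (trans (Y₁-off (root≢nonroot (J-root γ) ¬root-β) r) (Y-J γ r)))))) ⟨
      D Y₂  ≈⟨ D-repeated {u = i β} {i γ} iβ≢iγ (λ r → trans (update-off Y₁ (i γ) _ (i β) iβ≢iγ r)
                 (trans (update-at Y (i β) _ r) (trans (-‿cong (reflexive (cong (λ v → basis v r) eq)))
                   (sym (update-at Y₁ (i γ) _ r))))) ⟩
      0#    ∎
      where
      iβ≢iγ : i β ≢ i γ
      iβ≢iγ = β≢γ ∘ i-injective
      Y₁ = Y [ i β ≔ (λ r → - basis (top (i β)) r) ]
      Y₂ = Y₁ [ i γ ≔ (λ r → - basis (top (i γ)) r) ]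
      Y₁-off : ∀ {v} → v ≢ i β → Y₁ v ≋ Y v
      Y₁-off = update-off Y (i β) _ _

    D-degenerate : Degenerate f → D (family (basis ∘ i) direct) ≈ 0#
    D-degenerate (cyclic ¬root periodic)      = D-cyclic (basis ∘ i) ¬root periodic
    D-degenerate (unrooted acyclic β β∉J)     = trans (sym (D-compress acyclic (basis ∘ i))) (D-unrooted acyclic β β∉J)
    D-degenerate (shared acyclic β≢γ eq)    = trans (sym (D-compress acyclic (basis ∘ i))) (D-shared acyclic β≢γ eq)

-- The sum over admissible pairs

vecs⁺ : ∀ {a} {X : Set a} m {os : Fin m → List X} {f : Vec X m} → (∀ v → lookup f v ∈ os v) → f ∈ vecs m os
vecs⁺ zero    {f = []}    mem = here ≡.refl
vecs⁺ (suc m) {f = x ∷ f} mem = ∈-cartesianProductWith⁺ _∷_ (mem zero) (vecs⁺ m (mem ∘ suc))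

vecs⁻ : ∀ {a} {X : Set a} m {os : Fin m → List X} {f : Vec X m} → f ∈ vecs m os → ∀ v → lookup f v ∈ os v
vecs⁻ (suc m) {os} f∈ v with ∈-cartesianProductWith⁻ _∷_ (os zero) (vecs m (os ∘ suc)) f∈
vecs⁻ (suc m) f∈ zero    | _ , _ , x∈ , _ , ≡.refl = x∈
vecs⁻ (suc m) f∈ (suc v) | _ , _ , _ , f'∈ , ≡.refl = vecs⁻ m f'∈ v

vecs-unique : ∀ {a} {X : Set a} m {os : Fin m → List X} → (∀ v → Unique (os v)) → Unique (vecs m os)
vecs-unique zero    u = [] ∷ []
vecs-unique (suc m) u = Uniqueₚ.cartesianProductWith⁺ _∷_ ∷-injective (u zero) (vecs-unique m (u ∘ suc))

module _ {a b} {A : Set a} {B : Set b} (g : A → Maybe B) where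
  mapMaybe-∈⁺ : ∀ {xs x y} → x ∈ xs → g x ≡ just y → y ∈ mapMaybe g xs
  mapMaybe-∈⁺ {x ∷ xs} (here ≡.refl) eq rewrite eq = here ≡.refl
  mapMaybe-∈⁺ {x ∷ xs} (there x∈) eq with g x
  ... | just _  = there (mapMaybe-∈⁺ x∈ eq)
  ... | nothing = mapMaybe-∈⁺ x∈ eq

  mapMaybe-∈⁻ : ∀ xs {y} → y ∈ mapMaybe g xs → ∃ λ x → x ∈ xs × g x ≡ just y
  mapMaybe-∈⁻ (x ∷ xs) y∈ with g x in eq
  mapMaybe-∈⁻ (x ∷ xs) (here ≡.refl) | just _ = x , here ≡.refl , eq
  mapMaybe-∈⁻ (x ∷ xs) (there y∈) | just _ with x' , x'∈ , eq' ← mapMaybe-∈⁻ xs y∈ = x' , there x'∈ , eq'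
  mapMaybe-∈⁻ (x ∷ xs) y∈ | nothing with x' , x'∈ , eq' ← mapMaybe-∈⁻ xs y∈ = x' , there x'∈ , eq'

  mapMaybe-unique : (∀ {x x' y} → g x ≡ just y → g x' ≡ just y → x ≡ x') → ∀ {xs} → Unique xs → Unique (mapMaybe g xs)
  mapMaybe-unique inj {[]}     u = []
  mapMaybe-unique inj {x ∷ xs} u@(_ ∷ u') with g x in eq
  ... | nothing = mapMaybe-unique inj u'
  ... | just y  = unique-∷ fresh (mapMaybe-unique inj u')
    where
    fresh : ¬ (y ∈ mapMaybe g xs)
    fresh y∈ with x' , x'∈ , eq' ← mapMaybe-∈⁻ xs y∈ =
      unique-∉ u (≡.subst (_∈ xs) (inj eq' eq) x'∈)

module MatrixTree {c ℓ} (K : CommutativeRing c ℓ) {n p} (A : Fin n → Fin n → CommutativeRing.Carrier K)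
  (i j : Fin p → Fin n) (i-increasing : StrictlyIncreasing i) (j-increasing : StrictlyIncreasing j) where
  open CommutativeRing K hiding (zero)
  open RingProperties ring
  open SetoidReasoning setoid
  open Determinant K {n}
  open FamilyDeterminant K {n}
  open MinorAsDeterminant K {n}
  open Expansion K {n}

  private
    i-injective : ∀ {α β} → i α ≡ i β → α ≡ β
    i-injective = increasing-injective i-increasing
    j-injective : ∀ {α β} → j α ≡ j β → α ≡ β
    j-injective = increasing-injective j-increasing
  open Admissible i j i-injective j-injective
  open ForestDeterminant K i j i-injective j-injective

  Choice : Set
  Choice = Maybe (Fin n)

  -- In J, `nothing` is a placeholder of weight 1 that makes the vertex a root. Elsewhere `just v`
  -- is offered even at `v`: such a fixed point counts as a cycle, and its term vanishes.
  options : Fin n → List Choice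
  options v with inJ? v
  ... | yes _ = [ nothing ]
  ... | no  _ = nothing ∷ map just (allFin n)

  weight : Fin n → Choice → Carrier
  weight v x with inJ? v
  weight v x        | yes _ = 1#
  weight v nothing  | no  _ = colSum K A v
  weight v (just u) | no  _ = - A u v

  choiceColumn : Fin n → Choice → Column
  choiceColumn v x = family (basis ∘ i) (λ _ → arrow v x) v

  ∑-basis : ∀ (a : Fin n → Carrier) r → ∑ (allFin n) (λ u → a u * basis u r) ≈ a r
  ∑-basis a r = trans (reflexive (cong (sumL K) (map-tabulate (λ u → u) (λ u → a u * basis u r)))) (go (λ u → u) (λ eq → eq) r ≡.refl)
    where
    vanish : ∀ {m} (κ : Fin m → Fin n) → (∀ u → κ u ≢ r) → sumL K (tabulate (λ u → a (κ u) * basis (κ u) r)) ≈ 0#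
    vanish {zero}  κ off = refl
    vanish {suc m} κ off = trans (+-cong (trans (*-congˡ (basis-≢ (off zero))) (zeroʳ _)) (vanish (κ ∘ suc) (off ∘ suc)))
                                 (+-identityˡ 0#)
    go : ∀ {m} (κ : Fin m → Fin n) → (∀ {u v} → κ u ≡ κ v → u ≡ v) → ∀ u → κ u ≡ r →
         sumL K (tabulate (λ u → a (κ u) * basis (κ u) r)) ≈ a r
    go κ inj zero    ≡.refl = trans
      (+-cong (trans (*-congˡ (basis-refl r)) (*-identityʳ _)) (vanish (κ ∘ suc) (λ u eq → Finₚ.0≢1+n (inj (≡.sym eq)))))
      (+-identityʳ _)
    go κ inj (suc u) ≡.refl = trans
      (+-cong (trans (*-congˡ (basis-≢ (λ eq → Finₚ.0≢1+n (inj eq)))) (zeroʳ _)) (go (κ ∘ suc) (Finₚ.suc-injective ∘ inj) u ≡.refl))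
      (+-identityˡ _)

  -- The column sum times e_v cancels the e_v parts of the arrows, leaving the sum of `A u v` times
  -- e_u. The `- 0#` matches the shape of `arrow v nothing`.
  column-expand : ∀ v r → A r v ≈ colSum K A v * (basis v r + - 0#) + ∑ (allFin n) (λ u → - A u v * (basis v r + - basis u r))
  column-expand v r = sym (begin
    colSum K A v * (e + - 0#) + ∑ (allFin n) (λ u → - A u v * (e + - basis u r))
      ≈⟨ +-cong (trans (*-congˡ (trans (+-congˡ -0#≈0#) (+-identityʳ e))) (*-comm _ e))
                (split (allFin n)) ⟩
    e * ∑ (allFin n) (λ u → A u v) + (- (e * ∑ (allFin n) (λ u → A u v)) + ∑ (allFin n) (λ u → A u v * basis u r))
      ≈⟨ +-assoc _ _ _ ⟨
    (e * ∑ (allFin n) (λ u → A u v) + - (e * ∑ (allFin n) (λ u → A u v))) + ∑ (allFin n) (λ u → A u v * basis u r)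
      ≈⟨ +-cong (-‿inverseʳ _) (∑-basis (λ u → A u v) r) ⟩
    0# + A r v
      ≈⟨ +-identityˡ _ ⟩
    A r v ∎)
    where
    e = basis v r
    term : ∀ u → - A u v * (e + - basis u r) ≈ - (e * A u v) + A u v * basis u r
    term u = begin
      - A u v * (e + - basis u r)            ≈⟨ distribˡ _ _ _ ⟩
      - A u v * e + - A u v * - basis u r    ≈⟨ +-cong (sym (-‿distribˡ-* _ _)) (trans (sym (-‿distribˡ-* _ _)) (-‿cong (sym (-‿distribʳ-* _ _)))) ⟩
      - (A u v * e) + - - (A u v * basis u r) ≈⟨ +-cong (-‿cong (*-comm _ _)) (-‿involutive _) ⟩
      - (e * A u v) + A u v * basis u r      ∎
    split : ∀ us → ∑ us (λ u → - A u v * (e + - basis u r))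
              ≈ - (e * ∑ us (λ u → A u v)) + ∑ us (λ u → A u v * basis u r)
    split []       = sym (trans (+-identityʳ _) (trans (-‿cong (zeroʳ e)) -0#≈0#))
    split (u ∷ us) = begin
      - A u v * (e + - basis u r) + ∑ us (λ u → - A u v * (e + - basis u r))
        ≈⟨ +-cong (term u) (split us) ⟩
      (- (e * a) + b) + (- (e * s) + t)   ≈⟨ +-assoc _ _ _ ⟩
      - (e * a) + (b + (- (e * s) + t))   ≈⟨ +-congˡ (+-assoc _ _ _) ⟨
      - (e * a) + ((b + - (e * s)) + t)   ≈⟨ +-congˡ (+-congʳ (+-comm _ _)) ⟩
      - (e * a) + ((- (e * s) + b) + t)   ≈⟨ +-congˡ (+-assoc _ _ _) ⟩
      - (e * a) + (- (e * s) + (b + t))   ≈⟨ +-assoc _ _ _ ⟨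
      (- (e * a) + - (e * s)) + (b + t)   ≈⟨ +-congʳ (-‿+-comm _ _) ⟩
      - (e * a + e * s) + (b + t)         ≈⟨ +-congʳ (-‿cong (distribˡ e a s)) ⟨
      - (e * (a + s)) + (b + t)           ∎
      where
      a = A u v
      b = A u v * basis u r
      s = ∑ us (λ u → A u v)
      t = ∑ us (λ u → A u v * basis u r)

  replaced : Fin n → Column
  replaced = replaceColumns i j (column A)

  replaced-expand : ∀ v r → replaced v r ≈ ∑ (options v) (λ x → weight v x * choiceColumn v x r)
  replaced-expand v r with inJ? v
  ... | yes (α , ≡.refl) = trans (replaceColumns-at i j (column A) j-injective α r)
    (sym (trans (+-identityʳ _) (*-identityˡ _)))
  ... | no v∉J = trans (replaceColumns-off i j (column A) v (λ α eq → v∉J (α , eq)) r)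
    (trans (column-expand v r) (+-congˡ (sym (∑-map _ just (allFin n)))))

  choices : List (Parents n)
  choices = vecs n options

  J-rooted : Parents n → Set
  J-rooted f = ∀ α → Functional.Root f (j α)

  choices⇒J-rooted : ∀ {f} → f ∈ choices → J-rooted f
  choices⇒J-rooted {f} f∈ α with inJ? (j α) | vecs⁻ n f∈ (j α)
  ... | yes _   | here eq = eq
  ... | no  j∉J | _       = contradiction (α , ≡.refl) j∉J

  J-rooted⇒choices : ∀ {f} → J-rooted f → f ∈ choices
  J-rooted⇒choices {f} rooted = vecs⁺ n option
    where
    option : ∀ v → lookup f v ∈ options v
    option v with inJ? v | lookup f v in eq
    ... | yes (α , ≡.refl) | _       = here (≡.trans (≡.sym eq) (rooted α))
    ... | no _             | nothing = here ≡.refl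
    ... | no _             | just u  = there (∈-map⁺ just (∈-allFin u))

  choices-unique : Unique choices
  choices-unique = vecs-unique n option
    where
    option : ∀ v → Unique (options v)
    option v with inJ? v
    ... | yes _ = [] ∷ []
    ... | no  _ = All.tabulate distinct ∷ Uniqueₚ.map⁺ just-injective (Uniqueₚ.allFin⁺ n)
      where
      distinct : ∀ {x} → x ∈ map just (allFin n) → nothing ≢ x
      distinct x∈ ≡.refl with _ , _ , () ← ∈-map⁻ just x∈

  triple : ∀ f σ → Triple n p
  triple f σ = Functional.edges f , freeRoots f , σ

  J-rooted? : ∀ f → Dec (J-rooted f)
  J-rooted? f = Finₚ.all? (λ α → Functional.root? f (j α))

  -- On `choices`, where J consists of roots, `nothing` marks a degenerate map, whose term is zero,
  -- so `mapMaybe` drops such terms without changing the sum.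
  toTriple : Parents n → Maybe (Triple n p)
  toTriple f with J-rooted? f
  ... | no  _ = nothing
  ... | yes rooted with classify f rooted
  ...   | inj₁ (σ , _) = just (triple f σ)
  ...   | inj₂ _       = nothing

  toTriple-sound : ∀ f {F R σ} → toTriple f ≡ just (F , R , σ) →
                   Matching f σ × Functional.edges f ≡ F × freeRoots f ≡ R
  toTriple-sound f eq with J-rooted? f
  ... | yes rooted with classify f rooted
  toTriple-sound f ≡.refl | yes rooted | inj₁ (σ , m) = m , ≡.refl , ≡.refl

  choice-term : Parents n → Carrier
  choice-term f = ∏ (λ v → weight v (lookup f v)) * D (λ v → choiceColumn v (lookup f v))

  ∏-cong : ∀ {m} {g h : Fin m → Carrier} → (∀ v → g v ≈ h v) → ∏ g ≈ ∏ h
  ∏-cong {zero}  eq = refl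
  ∏-cong {suc m} eq = *-cong (eq zero) (∏-cong (eq ∘ suc))

  ∏-one : ∀ {m} {g : Fin m → Carrier} → (∀ v → g v ≈ 1#) → ∏ g ≈ 1#
  ∏-one {zero}  eq = refl
  ∏-one {suc m} eq = trans (*-cong (eq zero) (∏-one (eq ∘ suc))) (*-identityˡ 1#)

  ∏-single : ∀ {m} {g : Fin m → Carrier} u → (∀ v → v ≢ u → g v ≈ 1#) → ∏ g ≈ g u
  ∏-single zero    eq = trans (*-congˡ (∏-one (λ v → eq (suc v) λ ()))) (*-identityʳ _)
  ∏-single (suc u) eq = trans (*-cong (eq zero λ ()) (∏-single u (λ v v≢u → eq (suc v) (v≢u ∘ Finₚ.suc-injective)))) (*-identityˡ _)

  interchange : ∀ a b x y → (a * b) * (x * y) ≈ (a * x) * (b * y)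
  interchange a b x y = begin
    (a * b) * (x * y) ≈⟨ *-assoc a b _ ⟩
    a * (b * (x * y)) ≈⟨ *-congˡ (*-assoc b x y) ⟨
    a * ((b * x) * y) ≈⟨ *-congˡ (*-congʳ (*-comm b x)) ⟩
    a * ((x * b) * y) ≈⟨ *-congˡ (*-assoc x b y) ⟩
    a * (x * (b * y)) ≈⟨ *-assoc a x _ ⟨
    (a * x) * (b * y) ∎

  ∏-* : ∀ {m} (g h : Fin m → Carrier) → ∏ g * ∏ h ≈ ∏ (λ v → g v * h v)
  ∏-* {zero}  g h = *-identityˡ 1#
  ∏-* {suc m} g h = trans (interchange _ _ _ _) (*-congˡ (∏-* (g ∘ suc) (h ∘ suc)))

  ∏-swap : ∀ {l m} (g : Fin l → Fin m → Carrier) → ∏ (λ u → ∏ (g u)) ≈ ∏ (λ v → ∏ (λ u → g u v))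
  ∏-swap {zero}  g = sym (∏-one {g = λ v → ∏ (λ u → g u v)} (λ _ → refl))
  ∏-swap {suc l} g = trans (*-congˡ (∏-swap (g ∘ suc))) (∏-* (g zero) (λ v → ∏ (λ u → g (suc u) v)))

  module _ (f : Parents n) (rooted : J-rooted f) where
    open Functional f

    rootFactor : Fin n → Carrier
    rootFactor v = if lookup (freeRoots f) v then colSum K A v else 1#

    edgeFactor : Fin n → Fin n → Carrier
    edgeFactor u v = if lookup (lookup edges u) v then - A u v else 1#

    rootFactor-free : ∀ {v} → Root v → ¬ (∃ λ α → j α ≡ v) → rootFactor v ≡ colSum K A v
    rootFactor-free {v} root v∉J = cong (if_then colSum K A v else 1#) (⇒freeRoot f root v∉J)

    rootFactor-other : ∀ {v} → ¬ (Root v × ¬ (∃ λ α → j α ≡ v)) → rootFactor v ≡ 1#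
    rootFactor-other {v} ¬free with lookup (freeRoots f) v in eq
    ... | true  = contradiction (freeRoot⇒ f eq) ¬free
    ... | false = ≡.refl

    edgeFactor-parent : ∀ {u v} → parent v ≡ just u → edgeFactor u v ≡ - A u v
    edgeFactor-parent {u} {v} eq = cong (if_then - A u v else 1#) (parent⇒edge eq)

    edgeFactor-other : ∀ {u v} → parent v ≢ just u → edgeFactor u v ≡ 1#
    edgeFactor-other {u} {v} neq with lookup (lookup edges u) v in eq
    ... | true  = contradiction (edge⇒parent eq) neq
    ... | false = ≡.refl

    -- At most one edge ends in `v`, so the product over `u` has at most one factor besides the
    -- default 1.
    weight-factor : ∀ v → weight v (parent v) ≈ rootFactor v * ∏ (λ u → edgeFactor u v)
    weight-factor v with parent v in eq
    ... | nothing = trans root-weight (sym (trans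
            (*-congˡ (∏-one {g = λ u → edgeFactor u v} (λ u → reflexive (edgeFactor-other {u} {v} (λ e → contradiction eq (parent≢nothing e))))))
            (*-identityʳ _)))
      where
      root-weight : weight v nothing ≈ rootFactor v
      root-weight with inJ? v
      ... | yes v∈J = reflexive (≡.sym (rootFactor-other (λ (_ , v∉J) → v∉J v∈J)))
      ... | no  v∉J = reflexive (≡.sym (rootFactor-free eq v∉J))
    ... | just u = sym (begin
        rootFactor v * ∏ (λ w → edgeFactor w v)
          ≈⟨ *-cong (reflexive (rootFactor-other (λ (root , _) → parent≢nothing eq root)))
                    (∏-single {g = λ w → edgeFactor w v} u
                      (λ w w≢u → reflexive (edgeFactor-other {w} {v} (λ e → w≢u (same-parent e eq))))) ⟩
        1# * edgeFactor u v   ≈⟨ *-identityˡ _ ⟩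
        edgeFactor u v        ≡⟨ edgeFactor-parent eq ⟩
        - A u v               ≈⟨ nonroot-weight ⟨
        weight v (just u)     ∎)
      where
      nonroot-weight : weight v (just u) ≈ - A u v
      nonroot-weight with inJ? v
      ... | yes (α , ≡.refl) = contradiction (rooted α) (parent≢nothing eq)
      ... | no _ = refl

    -- `summand` groups the edges by source, whereas a choice belongs to the target of an edge;
    -- `∏-swap` regroups them.
    summand-triple : ∀ σ → summand K A (triple f σ) ≈ signature K σ * ∏ (λ v → weight v (parent v))
    summand-triple σ = *-congˡ (begin
      prodL K (map rootFactor (allFin n)) * prodL K (map (λ u → prodL K (map (edgeFactor u) (allFin n))) (allFin n))
        ≡⟨ ≡.cong₂ _*_ (cong (prodL K) (map-tabulate (λ v → v) rootFactor))
                       (cong (prodL K) (map-tabulate (λ u → u) (λ u → prodL K (map (edgeFactor u) (allFin n))))) ⟩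
      ∏ rootFactor * ∏ (λ u → prodL K (map (edgeFactor u) (allFin n)))
        ≈⟨ *-congˡ (∏-cong (λ u → reflexive (cong (prodL K) (map-tabulate (λ v → v) (edgeFactor u))))) ⟩
      ∏ rootFactor * ∏ (λ u → ∏ (edgeFactor u))
        ≈⟨ *-congˡ (∏-swap edgeFactor) ⟩
      ∏ rootFactor * ∏ (λ v → ∏ (λ u → edgeFactor u v))
        ≈⟨ ∏-* rootFactor _ ⟩
      ∏ (λ v → rootFactor v * ∏ (λ u → edgeFactor u v))
        ≈⟨ ∏-cong weight-factor ⟨
      ∏ (λ v → weight v (parent v)) ∎)

    choiceColumn≋direct : ∀ v → choiceColumn v (parent v) ≋ family (basis ∘ i) (direct f rooted) v
    choiceColumn≋direct v r with inJ? v
    ... | yes _ = refl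
    ... | no  _ = refl

  choice-term-toTriple : ∀ f → J-rooted f → choice-term f ≈ maybe′ (summand K A) 0# (toTriple f)
  choice-term-toTriple f rooted' with J-rooted? f
  ... | no ¬rooted = contradiction rooted' ¬rooted
  ... | yes rooted with classify f rooted
  ...   | inj₁ (σ , m) = trans
            (*-congˡ (trans (D-cong (choiceColumn≋direct f rooted)) (D-matching f rooted m)))
            (trans (*-comm _ _) (sym (summand-triple f rooted σ)))
  ...   | inj₂ degenerate = trans
            (*-congˡ (trans (D-cong (choiceColumn≋direct f rooted)) (D-degenerate f rooted degenerate)))
            (zeroʳ _)

  triples : List (Triple n p)
  triples = mapMaybe toTriple choices

  ∑-toTriple : ∀ fs → (∀ {f} → f ∈ fs → J-rooted f) → ∑ fs choice-term ≈ sumOver K A (mapMaybe toTriple fs)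
  ∑-toTriple []       rooted = refl
  ∑-toTriple (f ∷ fs) rooted with toTriple f | choice-term-toTriple f (rooted (here ≡.refl))
  ... | just t  | eq = +-cong eq (∑-toTriple fs (rooted ∘ there))
  ... | nothing | eq = trans (+-cong eq (∑-toTriple fs (rooted ∘ there))) (+-identityˡ _)

  -- Triples do not repeat because the edges determine the parent map. Every admissible pair occurs
  -- because its parent map is a matching, which rules out the degenerate outcome of `classify` and
  -- determines `σ`.
  triples-enumerate : EnumeratesAdmissible i j triples
  triples-enumerate = unique , sound , complete
    where
    unique : Unique triples
    unique = mapMaybe-unique toTriple
      (λ {f} {g} eq eq' → edges-injective (≡.trans (proj₁ (proj₂ (toTriple-sound f eq)))
                                           (≡.sym (proj₁ (proj₂ (toTriple-sound g eq'))))))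
      choices-unique
    sound : ∀ F R σ → (F , R , σ) ∈ triples → AdmissiblePair i j F R × IsSigma i j F σ
    sound F R σ t∈ with f , _ , eq ← mapMaybe-∈⁻ toTriple choices t∈
      with m , ≡.refl , ≡.refl ← toTriple-sound f eq = Matching.admissible m , Matching.isSigma m
    complete : ∀ F R σ → AdmissiblePair i j F R × IsSigma i j F σ → (F , R , σ) ∈ triples
    complete F R σ (pair , isSigma) =
      mapMaybe-∈⁺ toTriple (J-rooted⇒choices (Matching.J-root matching)) found
      where
      open FromPair {F} {R} {σ} pair isSigma
      found : toTriple parents ≡ just (F , R , σ)
      found with J-rooted? parents
      ... | no ¬rooted = contradiction (Matching.J-root matching) ¬rooted
      ... | yes rooted with classify parents rooted
      ...   | inj₁ (σ' , m) = cong just (≡.cong₂ _,_ edges≡F (≡.cong₂ _,_ freeRoots≡R (σ-determined m matching)))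
      ...   | inj₂ degenerate = contradiction degenerate (matching⇒¬degenerate parents matching)

  sumOver-↭ : ∀ {L L' : List (Triple n p)} → L ↭ L' → sumOver K A L ≈ sumOver K A L'
  sumOver-↭ Perm.refl         = refl
  sumOver-↭ (Perm.prep t eq)  = +-congˡ (sumOver-↭ eq)
  sumOver-↭ (Perm.swap t t' eq) = trans (sym (+-assoc _ _ _)) (trans (+-cong (+-comm _ _) (sumOver-↭ eq)) (+-assoc _ _ _))
  sumOver-↭ (Perm.trans eq eq') = trans (sumOver-↭ eq) (sumOver-↭ eq')

  -- `L` and `triples` are free of repetitions and have the same members, so one is a rearrangement
  -- of the other and the sums agree.
  minor-formula : ∀ L → EnumeratesAdmissible i j L →
    minor K A i j ≈ negPow K (indexSum i ℕ.+ indexSum j) * sumOver K A L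
  minor-formula L (unique , sound , complete) = trans (minor≈D A i j i-increasing j-increasing) (*-congˡ (begin
    D replaced               ≈⟨ multilinear-expand D-multilinear options weight choiceColumn replaced-expand ⟩
    ∑ choices choice-term    ≈⟨ ∑-toTriple choices choices⇒J-rooted ⟩
    sumOver K A triples      ≈⟨ sumOver-↭ (unique-↭ (proj₁ triples-enumerate) unique
                                  (λ t∈ → complete _ _ _ (proj₁ (proj₂ triples-enumerate) _ _ _ t∈))
                                  (λ t∈ → proj₂ (proj₂ triples-enumerate) _ _ _ (sound _ _ _ t∈))) ⟩
    sumOver K A L            ∎))

open import Data.Nat using (_+_)

theorem1 : ∀ {c ℓ} (K : CommutativeRing c ℓ)
    → (ι : ℚ → CommutativeRing.Carrier K)
    → RingMorphisms.IsRingMonomorphism (CommutativeRing.rawRing +-*-commutativeRing) (CommutativeRing.rawRing K) ι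
    → (n : ℕ) → 1 ≤ n
    → (A : Fin n → Fin n → CommutativeRing.Carrier K)
    → (p : ℕ) → 1 ≤ p → p ≤ n
    → (i j : Fin p → Fin n) → StrictlyIncreasing i → StrictlyIncreasing j
    → Σ (List (Triple n p)) (EnumeratesAdmissible i j)
    × ((L : List (Triple n p)) → EnumeratesAdmissible i j L
    → CommutativeRing._≈_ K (minor K A i j)
    (CommutativeRing._*_ K (negPow K (indexSum i + indexSum j)) (sumOver K A L)))
theorem1 K _ _ n _ A p _ _ i j i-increasing j-increasing = (triples , triples-enumerate) , minor-formula
  where open MatrixTree K A i j i-increasing j-increasing
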